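{- Let $M=(E,G)$ be a full-rank, $r$-dimensional claw-free matroid. Then $|E|\ge 2^{\lfloor r/2\rfloor}+2^{\lceil r/2\rceil}-2$. Equality holds precisely when either $M$ is isomorphic to $C_4$, or $E$ is the disjoint union of two flats of $G$ of dimensions $\lfloor r/2\rfloor$ and $\lceil r/2\rceil$.
   Context: A matroid is a pair $M=(E,G)$ where $G$ is the set of nonzero vectors of a finite-dimensional $\mathbb F_2$-vector space $V(G)=G\cup\{0\}\cong\mathbb F_2^r$ and $E\subseteq G$; $r$ is the dimension of $M$. Isomorphism: a linear isomorphism of ambient spaces mapping ground sets onto each other. A flat of $G$ is a set $F\subseteq G$ with $F\cup\{0\}$ a subspace; its dimension is that of the subspace. $M$ is full-rank if $E$ spans $V(G)$. $M|F=(E\cap F,F)$. A claw is $(B,G)$ with $\dim G=3$, $B$ a basis; $M$ is claw-free if no induced restriction $M|F$ is isomorphic to a claw. $C_4$ is the $3$-dimensional matroid whose ground set consists of four elements summing to zero (e.g. $e_1,e_2,e_3,e_1+e_2+e_3$ in $\mathbb F_2^3$). -}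

module Defs where

open import Data.Bool using (Bool; true; false; _xor_; if_then_else_)
open import Data.Nat using (ℕ; zero; suc; _+_)
open import Data.List using (List; []; _∷_; _++_; map; foldr)
open import Data.Vec using (Vec; []; _∷_; replicate; zipWith)
open import Data.Vec.Membership.Propositional using (_∈_)
open import Data.Product using (Σ; _×_; ∃)
open import Data.Sum using (_⊎_)
open import Data.Unit using (⊤)
open import Relation.Binary.PropositionalEquality using (_≡_; _≢_)
open import Relation.Nullary using (¬_)
open import Function.Bundles using (_⇔_)

-- The ambient space V(G) of an r-dimensional matroid is F₂^r, modelled as Vec Bool r
-- (addition = componentwise xor).  Every matroid is isomorphic to one of this form.
𝔽₂^ : ℕ → Set
𝔽₂^ r = Vec Bool r

𝟎 : {r : ℕ} → 𝔽₂^ r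
𝟎 {r} = replicate r false

infixl 6 _⊕_
_⊕_ : {r : ℕ} → 𝔽₂^ r → 𝔽₂^ r → 𝔽₂^ r
_⊕_ = zipWith _xor_

-- A (ground) set E ⊆ F₂^r given by its characteristic function.
-- M = (E, G) with G = F₂^r ∖ {0}; the condition E ⊆ G is  E 𝟎 ≡ false.
Pred₂ : ℕ → Set
Pred₂ r = 𝔽₂^ r → Bool

IsGroundSet : {r : ℕ} → Pred₂ r → Set
IsGroundSet E = E 𝟎 ≡ false

lincomb : {r k : ℕ} → Vec (𝔽₂^ r) k → 𝔽₂^ k → 𝔽₂^ r
lincomb [] [] = 𝟎
lincomb (b ∷ bs) (c ∷ cs) = (if c then b else 𝟎) ⊕ lincomb bs cs

LinIndep : {r k : ℕ} → Vec (𝔽₂^ r) k → Set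
LinIndep {k = k} b = (c : 𝔽₂^ k) → lincomb b c ≡ 𝟎 → c ≡ 𝟎

sumV : {r : ℕ} → List (𝔽₂^ r) → 𝔽₂^ r
sumV = foldr _⊕_ 𝟎

AllIn : {r : ℕ} → Pred₂ r → List (𝔽₂^ r) → Set
AllIn E [] = ⊤
AllIn E (x ∷ xs) = (E x ≡ true) × AllIn E xs

FullRank : {r : ℕ} → Pred₂ r → Set
FullRank {r} E = (v : 𝔽₂^ r) → Σ (List (𝔽₂^ r)) λ xs → AllIn E xs × sumV xs ≡ v

allVecs : (r : ℕ) → List (𝔽₂^ r)
allVecs zero = [] ∷ []
allVecs (suc r) = map (false ∷_) (allVecs r) ++ map (true ∷_) (allVecs r)

card : {r : ℕ} → Pred₂ r → ℕ
card {r} E = foldr (λ v n → (if E v then 1 else 0) + n) 0 (allVecs r)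

IsFlat : {r : ℕ} → ℕ → Pred₂ r → Set
IsFlat {r} k F = Σ (Vec (𝔽₂^ r) k) λ b → LinIndep b ×
  ((v : 𝔽₂^ r) → (F v ≡ true) ⇔ ((v ≢ 𝟎) × ∃ λ c → lincomb b c ≡ v))

-- Induced restriction M|F (F a flat spanned by the independent b₁..b_k) is isomorphic
-- to the k-dimensional matroid N = (E', F₂^k ∖ 0): the linear isomorphism
-- F₂^k → F ∪ {0}, c ↦ Σ cᵢ bᵢ maps the ground set E' onto E ∩ F.
InducedIso : {r k : ℕ} → Pred₂ r → Pred₂ k → Set
InducedIso {r} {k} E E' = Σ (Vec (𝔽₂^ r) k) λ b → LinIndep b ×
  ((c : 𝔽₂^ k) → c ≢ 𝟎 → E (lincomb b c) ≡ E' c)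

-- Isomorphism of matroids (E, F₂^r ∖ 0) ≅ (E', F₂^k ∖ 0): equal dimension and
-- a linear isomorphism F₂^k → F₂^r mapping E' onto E (an injective linear map
-- between spaces of equal dimension is an isomorphism).
Isomorphic : {r k : ℕ} → Pred₂ r → Pred₂ k → Set
Isomorphic {r} {k} E E' = (r ≡ k) × InducedIso E E'

IsClaw : Pred₂ 3 → Set
IsClaw B = Σ (Vec (𝔽₂^ 3) 3) λ b → LinIndep b × ((v : 𝔽₂^ 3) → (B v ≡ true) ⇔ (v ∈ b))

ClawFree : {r : ℕ} → Pred₂ r → Set
ClawFree E = (B : Pred₂ 3) → IsClaw B → ¬ InducedIso E B

C₄ : Pred₂ 3
C₄ (true  ∷ false ∷ false ∷ []) = true
C₄ (false ∷ true  ∷ false ∷ []) = true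
C₄ (false ∷ false ∷ true  ∷ []) = true
C₄ (true  ∷ true  ∷ true  ∷ []) = true
C₄ _ = false

{-# OPTIONS --safe #-}
module Submission where

-- Put N = E ∪ {𝟎} and call x, y ∈ N adjacent when x ⊕ y ∈ N.  Claw-freeness says
-- that three pairwise nonadjacent elements of N have their sum in N, a property
-- inherited by images under linear maps.  If x, y ∈ N are nonadjacent, every coset
-- of ⟨x, y⟩ that meets N does so in at least two elements, and the zero coset in
-- exactly three; hence ∣N∣ ≥ 2∣N/⟨x, y⟩∣ + 1, and the bound follows by induction in
-- steps of two.  (If there is no such pair, N is the whole space.)
--
-- In case of equality a nonzero coset never contains three elements of N, which
-- makes adjacency transitive on N ∖ {𝟎}.  If no three elements are pairwise
-- nonadjacent, the at most two adjacency classes are flats, whose dimensions are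
-- determined by their total size.  Three pairwise nonadjacent elements x, y, z
-- span a C₄, and the image of z in N/⟨x, y⟩ is adjacent to everything, so
-- ∣N/⟨x, y⟩∣ is even; but equality also holds for N/⟨x, y⟩, which makes
-- ∣N/⟨x, y⟩∣ odd as soon as r ≥ 4.

open import Defs
open import Algebra.Bundles using (CommutativeSemigroup)
import Algebra.Properties.CommutativeSemigroup as CommutativeSemigroupProperties
open import Data.Bool using (Bool; true; false; _∧_; _∨_; _xor_; not; if_then_else_)
import Data.Bool.Properties as Bool
open import Data.Fin using (Fin; zero; suc)
open import Data.Fin.Patterns using (0F; 1F; 2F)
open import Data.Fin.Subset using (⁅_⁆)
open import Data.Fin.Subset.Properties using (anySubset?)
open import Data.List using ([]; _∷_; foldr; map)
open import Data.List.Properties using (foldr-++; foldr-map)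
open import Data.Nat using (ℕ; zero; suc; _+_; _*_; _∸_; _^_; _≤_; _<_; z≤n; s≤s; ⌊_/2⌋; ⌈_/2⌉)
open import Data.Nat.Properties
open import Data.Product using (Σ; ∃; _×_; _,_; proj₁; proj₂)
open import Data.Sum as Sum using (_⊎_; inj₁; inj₂; [_,_]′)
open import Data.Vec using (Vec; []; _∷_; lookup; tail) renaming (map to vmap)
open import Data.Vec.Membership.Propositional using (_∈_)
open import Data.Vec.Properties using (≡-dec; zipWith-assoc; zipWith-comm; zipWith-identityˡ; zipWith-identityʳ)
open import Data.Vec.Relation.Unary.Any using (here; there)
open import Function using (_∘_; const; id)
open import Function.Bundles using (_⇔_; mk⇔; Equivalence)
open import Relation.Binary.PropositionalEquality
open import Relation.Nullary using (¬_; Dec; yes; no; does; contradiction)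
open import Relation.Nullary.Decidable using (dec-true; dec-false; _×-dec_; ¬?; decidable-stable)

private variable
  r k n : ℕ

-- Linear algebra over F₂

infix 4 _≟ᵛ_ _∋_ _∌_

_≟ᵛ_ : (u v : 𝔽₂^ r) → Dec (u ≡ v)
_≟ᵛ_ = ≡-dec Bool._≟_

_∋_ _∌_ : Pred₂ r → 𝔽₂^ r → Set
N ∋ v = N v ≡ true
N ∌ v = ¬ (N ∋ v)

∋-dec : (N : Pred₂ r) (v : 𝔽₂^ r) → Dec (N ∋ v)
∋-dec N v = N v Bool.≟ true

∌⇒false : (N : Pred₂ r) {v : 𝔽₂^ r} → N ∌ v → N v ≡ false
∌⇒false N = Bool.¬-not

⊕-assoc : (u v w : 𝔽₂^ r) → u ⊕ v ⊕ w ≡ u ⊕ (v ⊕ w)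
⊕-assoc = zipWith-assoc Bool.xor-assoc

⊕-comm : (u v : 𝔽₂^ r) → u ⊕ v ≡ v ⊕ u
⊕-comm = zipWith-comm Bool.xor-comm

⊕-identityˡ : (v : 𝔽₂^ r) → 𝟎 ⊕ v ≡ v
⊕-identityˡ = zipWith-identityˡ Bool.xor-identityˡ

⊕-identityʳ : (v : 𝔽₂^ r) → v ⊕ 𝟎 ≡ v
⊕-identityʳ = zipWith-identityʳ Bool.xor-identityʳ

⊕-self : (v : 𝔽₂^ r) → v ⊕ v ≡ 𝟎
⊕-self []      = refl
⊕-self (a ∷ v) = cong₂ _∷_ (Bool.xor-same a) (⊕-self v)

⊕-commutativeSemigroup : ℕ → CommutativeSemigroup _ _
⊕-commutativeSemigroup r = record
  { Carrier = 𝔽₂^ r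
  ; isCommutativeSemigroup = record
    { isSemigroup = record { isMagma = isMagma _⊕_ ; assoc = ⊕-assoc }
    ; comm = ⊕-comm
    }
  }

⊕-interchange : (a b c d : 𝔽₂^ r) → a ⊕ b ⊕ (c ⊕ d) ≡ a ⊕ c ⊕ (b ⊕ d)
⊕-interchange {r} = CommutativeSemigroupProperties.interchange (⊕-commutativeSemigroup r)

⊕≡𝟎⇒≡ : (u v : 𝔽₂^ r) → u ⊕ v ≡ 𝟎 → u ≡ v
⊕≡𝟎⇒≡ u v u⊕v≡𝟎 = begin
  u           ≡⟨ ⊕-identityʳ u ⟨
  u ⊕ 𝟎       ≡⟨ cong (u ⊕_) (⊕-self v) ⟨
  u ⊕ (v ⊕ v) ≡⟨ ⊕-assoc u v v ⟨
  u ⊕ v ⊕ v   ≡⟨ cong (_⊕ v) u⊕v≡𝟎 ⟩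
  𝟎 ⊕ v       ≡⟨ ⊕-identityˡ v ⟩
  v           ∎
  where open ≡-Reasoning

scale-xor : (a b : Bool) (v : 𝔽₂^ r) →
  (if a xor b then v else 𝟎) ≡ (if a then v else 𝟎) ⊕ (if b then v else 𝟎)
scale-xor true  true  v = sym (⊕-self v)
scale-xor true  false v = sym (⊕-identityʳ v)
scale-xor false b     v = sym (⊕-identityˡ _)

lincomb-⊕ : (ρ : Vec (𝔽₂^ r) k) (c d : 𝔽₂^ k) → lincomb ρ (c ⊕ d) ≡ lincomb ρ c ⊕ lincomb ρ d
lincomb-⊕ []      []      []      = sym (⊕-identityˡ 𝟎)
lincomb-⊕ (v ∷ ρ) (a ∷ c) (b ∷ d) = trans
  (cong₂ _⊕_ (scale-xor a b v) (lincomb-⊕ ρ c d))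
  (⊕-interchange _ _ _ _)

lincomb-𝟎 : (ρ : Vec (𝔽₂^ r) k) → lincomb ρ 𝟎 ≡ 𝟎
lincomb-𝟎 []      = refl
lincomb-𝟎 (v ∷ ρ) = trans (⊕-identityˡ _) (lincomb-𝟎 ρ)

-- As a Boolean vector, the singleton subset `⁅ i ⁆` is the i-th unit vector.
lincomb-⁅⁆ : (ρ : Vec (𝔽₂^ r) k) (i : Fin k) → lincomb ρ ⁅ i ⁆ ≡ lookup ρ i
lincomb-⁅⁆ (v ∷ ρ) zero    = trans (cong (v ⊕_) (lincomb-𝟎 ρ)) (⊕-identityʳ v)
lincomb-⁅⁆ (v ∷ ρ) (suc i) = trans (⊕-identityˡ _) (lincomb-⁅⁆ ρ i)

lincomb-injective : (b : Vec (𝔽₂^ r) k) → LinIndep b → ∀ {c d} → lincomb b c ≡ lincomb b d → c ≡ d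
lincomb-injective b indep {c} {d} eq = ⊕≡𝟎⇒≡ c d (indep (c ⊕ d) (begin
  lincomb b (c ⊕ d)           ≡⟨ lincomb-⊕ b c d ⟩
  lincomb b c ⊕ lincomb b d   ≡⟨ cong (_⊕ lincomb b d) eq ⟩
  lincomb b d ⊕ lincomb b d   ≡⟨ ⊕-self (lincomb b d) ⟩
  𝟎                           ∎))
  where open ≡-Reasoning

-- A reflective solver for F₂-linear identities: two expressions agree when
-- their coefficient vectors do.

infixl 6 _:⊕_

data Expr (n : ℕ) : Set where
  var  : Fin n → Expr n
  :𝟎   : Expr n
  _:⊕_ : Expr n → Expr n → Expr n

⟦_⟧ : Expr n → Vec (𝔽₂^ r) n → 𝔽₂^ r
⟦ var i  ⟧ ρ = lookup ρ i
⟦ :𝟎     ⟧ ρ = 𝟎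
⟦ s :⊕ t ⟧ ρ = ⟦ s ⟧ ρ ⊕ ⟦ t ⟧ ρ

coefficients : Expr n → 𝔽₂^ n
coefficients (var i)  = ⁅ i ⁆
coefficients :𝟎       = 𝟎
coefficients (s :⊕ t) = coefficients s ⊕ coefficients t

lincomb-coefficients : (ρ : Vec (𝔽₂^ r) n) (s : Expr n) → lincomb ρ (coefficients s) ≡ ⟦ s ⟧ ρ
lincomb-coefficients ρ (var i)  = lincomb-⁅⁆ ρ i
lincomb-coefficients ρ :𝟎       = lincomb-𝟎 ρ
lincomb-coefficients ρ (s :⊕ t) = trans
  (lincomb-⊕ ρ (coefficients s) (coefficients t))
  (cong₂ _⊕_ (lincomb-coefficients ρ s) (lincomb-coefficients ρ t))

solve : (ρ : Vec (𝔽₂^ r) n) (s t : Expr n) → coefficients s ≡ coefficients t → ⟦ s ⟧ ρ ≡ ⟦ t ⟧ ρ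
solve ρ s t eq = begin
  ⟦ s ⟧ ρ                    ≡⟨ lincomb-coefficients ρ s ⟨
  lincomb ρ (coefficients s) ≡⟨ cong (lincomb ρ) eq ⟩
  lincomb ρ (coefficients t) ≡⟨ lincomb-coefficients ρ t ⟩
  ⟦ t ⟧ ρ                    ∎
  where open ≡-Reasoning

pattern X = var 0F
pattern Y = var 1F
pattern Z = var 2F

-- Sums over F₂^r

∑ : (𝔽₂^ r → ℕ) → ℕ
∑ {zero}  f = f []
∑ {suc r} f = ∑ (λ v → f (false ∷ v)) + ∑ (λ v → f (true ∷ v))

ind : Bool → ℕ
ind b = if b then 1 else 0

δ : 𝔽₂^ r → 𝔽₂^ r → ℕ
δ w v = ind (does (v ≟ᵛ w))

∣_∣ : Pred₂ r → ℕ
∣ N ∣ = ∑ (ind ∘ N)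

+-interchange : (a b c d : ℕ) → a + b + (c + d) ≡ a + c + (b + d)
+-interchange = CommutativeSemigroupProperties.interchange +-commutativeSemigroup

foldr-allVecs : (f : 𝔽₂^ r → ℕ) (m : ℕ) → foldr (λ v s → f v + s) m (allVecs r) ≡ ∑ f + m
foldr-allVecs {zero}  f m = refl
foldr-allVecs {suc r} f m = begin
  foldr g m (allVecs (suc r))
    ≡⟨ foldr-++ g m (map (false ∷_) (allVecs r)) _ ⟩
  foldr g (foldr g m (map (true ∷_) (allVecs r))) (map (false ∷_) (allVecs r))
    ≡⟨ foldr-map g (false ∷_) _ (allVecs r) ⟩
  foldr (λ v s → f (false ∷ v) + s) (foldr g m (map (true ∷_) (allVecs r))) (allVecs r)
    ≡⟨ foldr-allVecs (λ v → f (false ∷ v)) _ ⟩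
  ∑ (λ v → f (false ∷ v)) + foldr g m (map (true ∷_) (allVecs r))
    ≡⟨ cong (∑ (λ v → f (false ∷ v)) +_) (trans (foldr-map g (true ∷_) m (allVecs r)) (foldr-allVecs (λ v → f (true ∷ v)) m)) ⟩
  ∑ (λ v → f (false ∷ v)) + (∑ (λ v → f (true ∷ v)) + m)
    ≡⟨ +-assoc (∑ (λ v → f (false ∷ v))) _ m ⟨
  ∑ f + m ∎
  where
  open ≡-Reasoning
  g : 𝔽₂^ (suc r) → ℕ → ℕ
  g v s = f v + s

card≡∣∣ : (N : Pred₂ r) → card N ≡ ∣ N ∣
card≡∣∣ N = trans (foldr-allVecs (ind ∘ N) 0) (+-identityʳ _)

∑-cong : {f g : 𝔽₂^ r → ℕ} → (∀ v → f v ≡ g v) → ∑ f ≡ ∑ g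
∑-cong {zero}  f≗g = f≗g []
∑-cong {suc r} f≗g = cong₂ _+_ (∑-cong (λ v → f≗g (false ∷ v))) (∑-cong (λ v → f≗g (true ∷ v)))

∑-mono-≤ : {f g : 𝔽₂^ r → ℕ} → (∀ v → f v ≤ g v) → ∑ f ≤ ∑ g
∑-mono-≤ {zero}  f≤g = f≤g []
∑-mono-≤ {suc r} f≤g = +-mono-≤ (∑-mono-≤ (λ v → f≤g (false ∷ v))) (∑-mono-≤ (λ v → f≤g (true ∷ v)))

∑-+ : (f g : 𝔽₂^ r → ℕ) → ∑ (λ v → f v + g v) ≡ ∑ f + ∑ g
∑-+ {zero}  f g = refl
∑-+ {suc r} f g = trans
  (cong₂ _+_ (∑-+ (λ v → f (false ∷ v)) _) (∑-+ (λ v → f (true ∷ v)) _))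
  (+-interchange (∑ (λ v → f (false ∷ v))) _ _ _)

∑-*ˡ : (m : ℕ) (f : 𝔽₂^ r → ℕ) → ∑ (λ v → m * f v) ≡ m * ∑ f
∑-*ˡ {zero}  m f = refl
∑-*ˡ {suc r} m f = trans
  (cong₂ _+_ (∑-*ˡ m (λ v → f (false ∷ v))) (∑-*ˡ m (λ v → f (true ∷ v))))
  (sym (*-distribˡ-+ m (∑ (λ v → f (false ∷ v))) _))

∑-0 : ∑ {r} (const 0) ≡ 0
∑-0 {zero}  = refl
∑-0 {suc r} = cong₂ _+_ (∑-0 {r}) (∑-0 {r})

∑-1 : ∑ {r} (const 1) ≡ 2 ^ r
∑-1 {zero}  = refl
∑-1 {suc r} = cong₂ _+_ (∑-1 {r}) (trans (∑-1 {r}) (sym (+-identityʳ _)))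

∑-swap : (f : 𝔽₂^ r → 𝔽₂^ k → ℕ) → ∑ (λ u → ∑ (f u)) ≡ ∑ (λ v → ∑ (λ u → f u v))
∑-swap {zero}  f = refl
∑-swap {suc r} f = trans
  (cong₂ _+_ (∑-swap (λ u → f (false ∷ u))) (∑-swap (λ u → f (true ∷ u))))
  (sym (∑-+ (λ v → ∑ (λ u → f (false ∷ u) v)) _))

∑-translate : (f : 𝔽₂^ r → ℕ) (u : 𝔽₂^ r) → ∑ (λ v → f (v ⊕ u)) ≡ ∑ f
∑-translate f []          = refl
∑-translate f (false ∷ u) =
  cong₂ _+_ (∑-translate (λ v → f (false ∷ v)) u) (∑-translate (λ v → f (true ∷ v)) u)
∑-translate f (true ∷ u)  = trans
  (cong₂ _+_ (∑-translate (λ v → f (true ∷ v)) u) (∑-translate (λ v → f (false ∷ v)) u))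
  (+-comm (∑ (λ v → f (true ∷ v))) _)

∑-unique : (f : 𝔽₂^ r → ℕ) (w : 𝔽₂^ r) → (∀ v → v ≢ w → f v ≡ 0) → ∑ f ≡ f w
∑-unique f []          zero-off = refl
∑-unique {suc r} f (false ∷ w) zero-off = trans
  (cong₂ _+_ (∑-unique (λ v → f (false ∷ v)) w (λ v v≢w → zero-off _ λ where refl → v≢w refl))
             (trans (∑-cong (λ v → zero-off (true ∷ v) (λ ()))) (∑-0 {r})))
  (+-identityʳ _)
∑-unique {suc r} f (true ∷ w)  zero-off =
  cong₂ _+_ (trans (∑-cong (λ v → zero-off (false ∷ v) (λ ()))) (∑-0 {r}))
            (∑-unique (λ v → f (true ∷ v)) w (λ v v≢w → zero-off _ λ where refl → v≢w refl))

δ-refl : (w : 𝔽₂^ r) → δ w w ≡ 1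
δ-refl w = cong ind (dec-true (w ≟ᵛ w) refl)

δ-≢ : {v w : 𝔽₂^ r} → v ≢ w → δ w v ≡ 0
δ-≢ {v = v} {w} v≢w = cong ind (dec-false (v ≟ᵛ w) v≢w)

∑-δ : (w : 𝔽₂^ r) → ∑ (δ w) ≡ 1
∑-δ w = trans (∑-unique (δ w) w (λ _ → δ-≢)) (δ-refl w)

-- Strictness at the one point `w` leaves room for a unit mass there, which reduces a strict
-- inequality of sums to a weak pointwise one.
+δ-≤ : {f g : 𝔽₂^ r → ℕ} (w : 𝔽₂^ r) → (∀ v → f v ≤ g v) → f w < g w → ∀ v → f v + δ w v ≤ g v
+δ-≤ {f = f} w f≤g fw<gw v with v ≟ᵛ w
... | yes refl = ≤-trans (≤-reflexive (+-comm (f v) 1)) fw<gw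
... | no _     = ≤-trans (≤-reflexive (+-identityʳ (f v))) (f≤g v)

∑-+δ : (f : 𝔽₂^ r → ℕ) (w : 𝔽₂^ r) → ∑ (λ v → f v + δ w v) ≡ suc (∑ f)
∑-+δ f w = trans (∑-+ f (δ w)) (trans (cong (∑ f +_) (∑-δ w)) (+-comm (∑ f) 1))

∑-mono-< : {f g : 𝔽₂^ r → ℕ} (w : 𝔽₂^ r) → (∀ v → f v ≤ g v) → f w < g w → ∑ f < ∑ g
∑-mono-< {f = f} w f≤g fw<gw = ≤-trans (≤-reflexive (sym (∑-+δ f w))) (∑-mono-≤ (+δ-≤ w f≤g fw<gw))

-- The unit added at `w` does not change the value at `w′`, so the strict comparison applies a
-- second time there.
∑-mono-<₂ : {f g : 𝔽₂^ r → ℕ} (w w′ : 𝔽₂^ r) → w ≢ w′ →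
  (∀ v → f v ≤ g v) → f w < g w → f w′ < g w′ → 2 + ∑ f ≤ ∑ g
∑-mono-<₂ {f = f} {g} w w′ w≢w′ f≤g fw<gw fw′<gw′ = ≤-trans
  (≤-reflexive (cong suc (sym (∑-+δ f w))))
  (∑-mono-< w′ (+δ-≤ w f≤g fw<gw) (≤-trans (≤-reflexive (cong suc fw′+0)) fw′<gw′))
  where
  fw′+0 : f w′ + δ w w′ ≡ f w′
  fw′+0 = trans (cong (f w′ +_) (δ-≢ (w≢w′ ∘ sym))) (+-identityʳ (f w′))

module _ (φ : 𝔽₂^ k → 𝔽₂^ r) (φ-injective : ∀ {c d} → φ c ≡ φ d → c ≡ d) (f : 𝔽₂^ r → ℕ) where

  -- Counts the pairs `(c , v)` with `φ c ≡ v`, weighted by `f v`. Summing over `v` first gives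
  -- `∑ (f ∘ φ)`; for fixed `v`, injectivity leaves `f v` on the image and 0 off it.
  fibreSum : 𝔽₂^ r → ℕ
  fibreSum v = ∑ (λ c → δ (φ c) v * f v)

  fibreSum-image : (c : 𝔽₂^ k) → fibreSum (φ c) ≡ f (φ c)
  fibreSum-image c = trans
    (∑-unique _ c (λ d d≢c → cong (_* f (φ c)) (δ-≢ (λ eq → d≢c (sym (φ-injective eq))))))
    (trans (cong (_* f (φ c)) (δ-refl (φ c))) (*-identityˡ _))

  fibreSum-outside : (v : 𝔽₂^ r) → ¬ ∃ (λ c → φ c ≡ v) → fibreSum v ≡ 0
  fibreSum-outside v v∉φ = trans
    (∑-cong (λ c → cong (_* f v) (δ-≢ (λ eq → v∉φ (c , sym eq)))))
    (∑-0 {k})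

  ∑-image : ∑ (f ∘ φ) ≡ ∑ fibreSum
  ∑-image = begin
    ∑ (λ c → f (φ c))                       ≡⟨ ∑-cong (λ c → sym (trans
                                                 (∑-unique (λ v → δ (φ c) v * f v) (φ c) (λ v v≢φc → cong (_* f v) (δ-≢ v≢φc)))
                                                 (trans (cong (_* f (φ c)) (δ-refl (φ c))) (*-identityˡ _)))) ⟩
    ∑ (λ c → ∑ (λ v → δ (φ c) v * f v))     ≡⟨ ∑-swap (λ c v → δ (φ c) v * f v) ⟩
    ∑ fibreSum                              ∎
    where open ≡-Reasoning

  image? : (v : 𝔽₂^ r) → Dec (∃ λ c → φ c ≡ v)
  -- A subset of `Fin k` is a Boolean vector, so `anySubset?` searches all of `𝔽₂^ k`.
  image? v = anySubset? (λ c → φ c ≟ᵛ v)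

  ∑-injection-≤ : ∑ (f ∘ φ) ≤ ∑ f
  ∑-injection-≤ = ≤-trans (≤-reflexive ∑-image) (∑-mono-≤ pointwise)
    where
    pointwise : ∀ v → fibreSum v ≤ f v
    pointwise v with image? v
    ... | yes (c , refl) = ≤-reflexive (fibreSum-image c)
    ... | no v∉φ         = ≤-trans (≤-reflexive (fibreSum-outside v v∉φ)) z≤n

  ∑-injection-≡ : (∀ v → ¬ ∃ (λ c → φ c ≡ v) → f v ≡ 0) → ∑ (f ∘ φ) ≡ ∑ f
  ∑-injection-≡ f≡0 = trans ∑-image (∑-cong pointwise)
    where
    pointwise : ∀ v → fibreSum v ≡ f v
    pointwise v with image? v
    ... | yes (c , refl) = fibreSum-image c
    ... | no v∉φ         = trans (fibreSum-outside v v∉φ) (sym (f≡0 v v∉φ))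

-- Quotients

-- The quotient map by ⟨e⟩ clears and then drops the coordinate of the first
-- nonzero entry of e; for e = 𝟎 the value is junk.
proj : 𝔽₂^ (suc r) → 𝔽₂^ (suc r) → 𝔽₂^ r
proj         (true  ∷ e)  (a ∷ v) = v ⊕ (if a then e else 𝟎)
proj {zero}  (false ∷ []) _       = []
proj {suc r} (false ∷ e)  (a ∷ v) = a ∷ proj e v

-- For nonzero `e`, the representative with entry `false` at the coordinate that `proj e` drops.
sect : 𝔽₂^ (suc r) → 𝔽₂^ r → 𝔽₂^ (suc r)
sect         (true  ∷ e)  w       = false ∷ w
sect {zero}  (false ∷ []) []      = 𝟎
sect {suc r} (false ∷ e)  (a ∷ w) = a ∷ sect e w

proj-⊕ : (e u v : 𝔽₂^ (suc r)) → proj e (u ⊕ v) ≡ proj e u ⊕ proj e v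
proj-⊕         (true  ∷ e)  (a ∷ u) (b ∷ v) =
  trans (cong (u ⊕ v ⊕_) (scale-xor a b e)) (⊕-interchange u v _ _)
proj-⊕ {zero}  (false ∷ []) u       v       = refl
proj-⊕ {suc r} (false ∷ e)  (a ∷ u) (b ∷ v) = cong ((a xor b) ∷_) (proj-⊕ e u v)

proj-self : (e : 𝔽₂^ (suc r)) → proj e e ≡ 𝟎
proj-self         (true  ∷ e)  = ⊕-self e
proj-self {zero}  (false ∷ []) = refl
proj-self {suc r} (false ∷ e)  = cong (false ∷_) (proj-self e)

proj-sect : (e : 𝔽₂^ (suc r)) (w : 𝔽₂^ r) → proj e (sect e w) ≡ w
proj-sect         (true  ∷ e)  w       = ⊕-identityʳ w
proj-sect {zero}  (false ∷ []) []      = refl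
proj-sect {suc r} (false ∷ e)  (a ∷ w) = cong (a ∷_) (proj-sect e w)

proj-kernel : (e v : 𝔽₂^ (suc r)) → e ≢ 𝟎 → proj e v ≡ 𝟎 → v ≡ 𝟎 ⊎ v ≡ e
proj-kernel         (true  ∷ e)  (true  ∷ v) _   eq = inj₂ (cong (true ∷_) (⊕≡𝟎⇒≡ v e eq))
proj-kernel         (true  ∷ e)  (false ∷ v) _   eq = inj₁ (cong (false ∷_) (⊕≡𝟎⇒≡ v 𝟎 eq))
proj-kernel {zero}  (false ∷ []) v           e≢𝟎 eq = contradiction refl e≢𝟎
proj-kernel {suc r} (false ∷ e)  (true  ∷ v) e≢𝟎 ()
proj-kernel {suc r} (false ∷ e)  (false ∷ v) e≢𝟎 eq
  with proj-kernel e v (e≢𝟎 ∘ cong (false ∷_)) (cong tail eq)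
... | inj₁ refl = inj₁ refl
... | inj₂ refl = inj₂ refl

-- The points `sect e w` and `sect e w ⊕ e` make up one coset of `⟨e⟩` for each `w`. At the pivot, a
-- translation identifies the second summands with the half of the sum with leading `true`.
∑-cosets : (e : 𝔽₂^ (suc r)) → e ≢ 𝟎 → (f : 𝔽₂^ (suc r) → ℕ) →
  ∑ f ≡ ∑ (λ w → f (sect e w) + f (sect e w ⊕ e))
∑-cosets (true ∷ e) _ f = sym (trans
  (∑-+ (λ w → f (false ∷ w)) (λ w → f (true ∷ (w ⊕ e))))
  (cong (∑ (λ w → f (false ∷ w)) +_) (∑-translate (λ w → f (true ∷ w)) e)))
∑-cosets {zero}  (false ∷ []) e≢𝟎 f = contradiction refl e≢𝟎
∑-cosets {suc r} (false ∷ e)  e≢𝟎 f = cong₂ _+_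
  (∑-cosets e (e≢𝟎 ∘ cong (false ∷_)) (λ v → f (false ∷ v)))
  (∑-cosets e (e≢𝟎 ∘ cong (false ∷_)) (λ v → f (true ∷ v)))

-- Translation by `z` pairs off the vectors, and `N` contains both or neither of each pair.
even-card : (N : Pred₂ r) (z : 𝔽₂^ r) → z ≢ 𝟎 → (∀ v → N v ≡ N (v ⊕ z)) → ∃ λ m → ∣ N ∣ ≡ 2 * m
even-card {zero}  N []  z≢𝟎 _   = contradiction refl z≢𝟎
even-card {suc r} N z z≢𝟎 inv = ∑ half , (begin
  ∣ N ∣                                                     ≡⟨ ∑-cosets z z≢𝟎 (ind ∘ N) ⟩
  ∑ (λ w → ind (N (sect z w)) + ind (N (sect z w ⊕ z)))   ≡⟨ ∑-cong (λ w → cong (half w +_) (trans (cong ind (sym (inv (sect z w)))) (sym (+-identityʳ (half w))))) ⟩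
  ∑ (λ w → 2 * half w)                                     ≡⟨ ∑-*ˡ 2 half ⟩
  2 * ∑ half                                               ∎)
  where
  open ≡-Reasoning
  half : 𝔽₂^ r → ℕ
  half w = ind (N (sect z w))

-- Quotients by a plane

data InPlane (x y : 𝔽₂^ r) : 𝔽₂^ r → Set where
  is-𝟎   : InPlane x y 𝟎
  is-x   : InPlane x y x
  is-y   : InPlane x y y
  is-x⊕y : InPlane x y (x ⊕ y)

-- For independent `x` and `y`, the sum of `f` over the coset of `⟨x, y⟩` through `t`.
cosetSum : 𝔽₂^ r → 𝔽₂^ r → (𝔽₂^ r → ℕ) → 𝔽₂^ r → ℕ
cosetSum x y f t = f t + f (t ⊕ x) + (f (t ⊕ y) + f (t ⊕ x ⊕ y))

-- Translation by an element of the plane permutes the four summands.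
cosetSum-shift : (x y : 𝔽₂^ r) (f : 𝔽₂^ r → ℕ) (t : 𝔽₂^ r) {p : 𝔽₂^ r} → InPlane x y p →
  cosetSum x y f (t ⊕ p) ≡ cosetSum x y f t
cosetSum-shift x y f t is-𝟎 = cong (cosetSum x y f) (⊕-identityʳ t)
cosetSum-shift x y f t is-x = cong₂ _+_
  (trans (+-comm (f (t ⊕ x)) _) (cong (_+ f (t ⊕ x)) (cong f (solve (t ∷ x ∷ y ∷ []) (X :⊕ Y :⊕ Y) X refl))))
  (trans (+-comm (f (t ⊕ x ⊕ y)) _) (cong (_+ f (t ⊕ x ⊕ y)) (cong f (solve (t ∷ x ∷ y ∷ []) (X :⊕ Y :⊕ Y :⊕ Z) (X :⊕ Z) refl))))
cosetSum-shift x y f t is-y = trans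
  (+-comm (f (t ⊕ y) + f (t ⊕ y ⊕ x)) _)
  (cong₂ _+_
    (cong₂ _+_ (cong f (solve (t ∷ x ∷ y ∷ []) (X :⊕ Z :⊕ Z) X refl))
               (cong f (solve (t ∷ x ∷ y ∷ []) (X :⊕ Z :⊕ Y :⊕ Z) (X :⊕ Y) refl)))
    (cong (f (t ⊕ y) +_) (cong f (solve (t ∷ x ∷ y ∷ []) (X :⊕ Z :⊕ Y) (X :⊕ Y :⊕ Z) refl))))
cosetSum-shift x y f t is-x⊕y = begin
  cosetSum x y f (t ⊕ (x ⊕ y)) ≡⟨ cong (cosetSum x y f) (⊕-assoc t x y) ⟨
  cosetSum x y f (t ⊕ x ⊕ y)   ≡⟨ cosetSum-shift x y f (t ⊕ x) is-y ⟩
  cosetSum x y f (t ⊕ x)       ≡⟨ cosetSum-shift x y f t is-x ⟩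
  cosetSum x y f t             ∎
  where open ≡-Reasoning

-- The quotient by `⟨x, y⟩` in coordinates: `σ` is a section of `π`, and `∑-π` is summation coset by
-- coset. The counting arguments see the coordinates only through these laws.
record PlaneQuotient (x y : 𝔽₂^ (2 + r)) : Set where
  field
    π      : 𝔽₂^ (2 + r) → 𝔽₂^ r
    σ      : 𝔽₂^ r → 𝔽₂^ (2 + r)
    π-⊕    : ∀ u v → π (u ⊕ v) ≡ π u ⊕ π v
    π-σ    : ∀ w → π (σ w) ≡ w
    π-x    : π x ≡ 𝟎
    π-y    : π y ≡ 𝟎
    kernel : ∀ v → π v ≡ 𝟎 → InPlane x y v
    ∑-π    : ∀ f → ∑ f ≡ ∑ (λ w → cosetSum x y f (σ w))

  π-𝟎 : π 𝟎 ≡ 𝟎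
  π-𝟎 = begin
    π 𝟎           ≡⟨ cong π (⊕-self 𝟎) ⟨
    π (𝟎 ⊕ 𝟎)     ≡⟨ π-⊕ 𝟎 𝟎 ⟩
    π 𝟎 ⊕ π 𝟎     ≡⟨ ⊕-self (π 𝟎) ⟩
    𝟎             ∎
    where open ≡-Reasoning

  -- `σ (π v)` and `v` have the same image, so they lie in the same coset.
  cosetSum-σπ : ∀ f v → cosetSum x y f (σ (π v)) ≡ cosetSum x y f v
  cosetSum-σπ f v = begin
    cosetSum x y f (σ (π v))           ≡⟨ cong (cosetSum x y f) (solve (σ (π v) ∷ v ∷ []) X (Y :⊕ (X :⊕ Y)) refl) ⟩
    cosetSum x y f (v ⊕ (σ (π v) ⊕ v)) ≡⟨ cosetSum-shift x y f v (kernel _ (trans (π-⊕ _ _) (trans (cong (_⊕ π v) (π-σ (π v))) (⊕-self (π v))))) ⟩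
    cosetSum x y f v                   ∎
    where open ≡-Reasoning

-- Divides out `x` and then the image `ȳ` of `y`, which is nonzero because `y` is neither `𝟎` nor
-- `x`.
planeQuotient : (x y : 𝔽₂^ (2 + r)) → x ≢ 𝟎 → y ≢ 𝟎 → x ≢ y → PlaneQuotient x y
planeQuotient {r} x y x≢𝟎 y≢𝟎 x≢y = record
  { π      = proj ȳ ∘ proj x
  ; σ      = sect x ∘ sect ȳ
  ; π-⊕    = λ u v → trans (cong (proj ȳ) (proj-⊕ x u v)) (proj-⊕ ȳ _ _)
  ; π-σ    = λ w → trans (cong (proj ȳ) (proj-sect x _)) (proj-sect ȳ w)
  ; π-x    = trans (cong (proj ȳ) (proj-self x)) proj-𝟎
  ; π-y    = proj-self ȳ
  ; kernel = kernel
  ; ∑-π    = λ f → trans (∑-cosets x x≢𝟎 f) (trans (∑-cosets ȳ ȳ≢𝟎 (λ u → f (sect x u) + f (sect x u ⊕ x))) (∑-cong (regroup f)))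
  }
  where
  ȳ : 𝔽₂^ (suc r)
  ȳ = proj x y

  ȳ≢𝟎 : ȳ ≢ 𝟎
  ȳ≢𝟎 eq with proj-kernel x y x≢𝟎 eq
  ... | inj₁ y≡𝟎 = y≢𝟎 y≡𝟎
  ... | inj₂ y≡x = x≢y (sym y≡x)

  proj-𝟎 : proj ȳ 𝟎 ≡ 𝟎
  proj-𝟎 = trans (cong (proj ȳ) (sym (⊕-self 𝟎))) (trans (proj-⊕ ȳ 𝟎 𝟎) (⊕-self _))

  kernel : ∀ v → proj ȳ (proj x v) ≡ 𝟎 → InPlane x y v
  kernel v eq with proj-kernel ȳ (proj x v) ȳ≢𝟎 eq
  ... | inj₁ v̄≡𝟎 with proj-kernel x v x≢𝟎 v̄≡𝟎
  ...   | inj₁ refl = is-𝟎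
  ...   | inj₂ refl = is-x
  kernel v eq | inj₂ v̄≡ȳ
    with proj-kernel x (v ⊕ y) x≢𝟎 (trans (proj-⊕ x v y) (trans (cong (_⊕ ȳ) v̄≡ȳ) (⊕-self ȳ)))
  ...   | inj₁ v⊕y≡𝟎 = subst (InPlane x y) (sym (⊕≡𝟎⇒≡ v y v⊕y≡𝟎)) is-y
  ...   | inj₂ v⊕y≡x = subst (InPlane x y)
    (trans (cong (_⊕ y) (sym v⊕y≡x)) (solve (v ∷ y ∷ []) (X :⊕ Y :⊕ Y) X refl)) is-x⊕y

  -- Modulo `x`, the lift `s` agrees with `t ⊕ y`, so it is `t ⊕ y` or `t ⊕ x ⊕ y`. Either way `s`
  -- and `s ⊕ x` are these two points in some order.
  regroup : (f : 𝔽₂^ (2 + r) → ℕ) (w : 𝔽₂^ r) →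
    let t = sect x (sect ȳ w); s = sect x (sect ȳ w ⊕ ȳ) in
    f t + f (t ⊕ x) + (f s + f (s ⊕ x)) ≡ cosetSum x y f t
  regroup f w = cong (f t + f (t ⊕ x) +_) step
    where
    t s : 𝔽₂^ (2 + r)
    t = sect x (sect ȳ w)
    s = sect x (sect ȳ w ⊕ ȳ)
    s̄⊕t̄⊕ȳ≡𝟎 : proj x (s ⊕ (t ⊕ y)) ≡ 𝟎
    s̄⊕t̄⊕ȳ≡𝟎 = begin
      proj x (s ⊕ (t ⊕ y))               ≡⟨ trans (proj-⊕ x s _) (cong (proj x s ⊕_) (proj-⊕ x t y)) ⟩
      proj x s ⊕ (proj x t ⊕ ȳ)          ≡⟨ cong₂ (λ p q → p ⊕ (q ⊕ ȳ)) (proj-sect x _) (proj-sect x _) ⟩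
      sect ȳ w ⊕ ȳ ⊕ (sect ȳ w ⊕ ȳ)      ≡⟨ ⊕-self _ ⟩
      𝟎                                  ∎
      where open ≡-Reasoning
    step : f s + f (s ⊕ x) ≡ f (t ⊕ y) + f (t ⊕ x ⊕ y)
    step with proj-kernel x _ x≢𝟎 s̄⊕t̄⊕ȳ≡𝟎
    ... | inj₁ eq = cong₂ _+_ (cong f s≡) (cong f (trans (cong (_⊕ x) s≡) (solve (t ∷ x ∷ y ∷ []) (X :⊕ Z :⊕ Y) (X :⊕ Y :⊕ Z) refl)))
      where
      s≡ : s ≡ t ⊕ y
      s≡ = ⊕≡𝟎⇒≡ s _ eq
    ... | inj₂ eq = trans (+-comm (f s) _) (cong₂ _+_
        (cong f (trans (cong (_⊕ x) s≡) (solve (t ∷ x ∷ y ∷ []) (X :⊕ Y :⊕ Z :⊕ Y) (X :⊕ Z) refl)))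
        (cong f s≡))
      where
      s≡ : s ≡ t ⊕ x ⊕ y
      s≡ = trans (solve (s ∷ t ∷ y ∷ []) X (Y :⊕ (X :⊕ (Y :⊕ Z)) :⊕ Z) refl) (cong (λ p → t ⊕ p ⊕ y) eq)

-- Claw-free sets containing 𝟎

-- For N ∋ 𝟎 the independence of a claw is automatic: a triple violating the
-- condition is linearly independent.
NoClaw : Pred₂ r → Set
NoClaw N = ∀ {x y z} → N ∋ x → N ∋ y → N ∋ z →
  N ∌ x ⊕ y → N ∌ x ⊕ z → N ∌ y ⊕ z → N ∋ x ⊕ y ⊕ z

-- Phrased as an induction principle, spanning passes to a quotient by composing the predicate with
-- the quotient map.
Spanning : Pred₂ r → Set₁
Spanning {r} N = (P : 𝔽₂^ r → Set) → (∀ {u v} → P u → P v → P (u ⊕ v)) →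
  (∀ {v} → N ∋ v → P v) → ∀ v → P v

Nonadjacent : Pred₂ r → 𝔽₂^ r → 𝔽₂^ r → Set
Nonadjacent N x y = N ∋ x × N ∋ y × N ∌ x ⊕ y

nonadjacent? : (N : Pred₂ r) (x y : 𝔽₂^ r) → Dec (Nonadjacent N x y)
nonadjacent? N x y = ∋-dec N x ×-dec ∋-dec N y ×-dec ¬? (∋-dec N (x ⊕ y))

Closed : Pred₂ r → Set
Closed N = ∀ {u v} → N ∋ u → N ∋ v → N ∋ u ⊕ v

closed⊎nonadjacent : (N : Pred₂ r) → Closed N ⊎ ∃ λ x → ∃ λ y → Nonadjacent N x y
closed⊎nonadjacent N with anySubset? (λ x → anySubset? (nonadjacent? N x))
... | yes pair = inj₂ pair
... | no ¬pair = inj₁ λ {u} {v} u∈N v∈N →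
  decidable-stable (∋-dec N _) λ u⊕v∉N → ¬pair (u , v , u∈N , v∈N , u⊕v∉N)

∋-subst : (N : Pred₂ r) {u v : 𝔽₂^ r} → u ≡ v → N ∋ u → N ∋ v
∋-subst N = subst (N ∋_)

nonadjacent⇒x≢𝟎 : (N : Pred₂ r) {x y : 𝔽₂^ r} → Nonadjacent N x y → x ≢ 𝟎
nonadjacent⇒x≢𝟎 N {y = y} (_ , y∈N , x⊕y∉N) refl = x⊕y∉N (∋-subst N (sym (⊕-identityˡ y)) y∈N)

nonadjacent⇒y≢𝟎 : (N : Pred₂ r) {x y : 𝔽₂^ r} → Nonadjacent N x y → y ≢ 𝟎
nonadjacent⇒y≢𝟎 N {x} (x∈N , _ , x⊕y∉N) refl = x⊕y∉N (∋-subst N (sym (⊕-identityʳ x)) x∈N)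

nonadjacent⇒x≢y : (N : Pred₂ r) → N ∋ 𝟎 → {x y : 𝔽₂^ r} → Nonadjacent N x y → x ≢ y
nonadjacent⇒x≢y N 0∈N {x} (_ , _ , x⊕y∉N) refl = x⊕y∉N (∋-subst N (sym (⊕-self x)) 0∈N)

-- In dimension at most 1 the sum of two vectors is `𝟎` or one of the two, so it cannot leave `N`.
nonadjacent-dim : (N : Pred₂ r) → N ∋ 𝟎 → ∀ {x y} → Nonadjacent N x y → ∃ λ k → r ≡ 2 + k
nonadjacent-dim {suc (suc k)} N 0∈N _ = k , refl
nonadjacent-dim {0} N 0∈N {[]} {[]} (_ , _ , x⊕y∉N) = contradiction 0∈N x⊕y∉N
nonadjacent-dim {1} N 0∈N {false ∷ []} {y ∷ []}     (_ , y∈N , x⊕y∉N) = contradiction y∈N x⊕y∉N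
nonadjacent-dim {1} N 0∈N {true ∷ []}  {false ∷ []} (x∈N , _ , x⊕y∉N) = contradiction x∈N x⊕y∉N
nonadjacent-dim {1} N 0∈N {true ∷ []}  {true ∷ []}  (_ , _ , x⊕y∉N)   = contradiction 0∈N x⊕y∉N

positive : ℕ → Bool
positive zero    = false
positive (suc _) = true

positive⁺ : {m : ℕ} → 0 < m → positive m ≡ true
positive⁺ (s≤s _) = refl

-- Were `v` the only element of `N` in its coset, `x`, `y` and `v` would be pairwise nonadjacent,
-- and `noClaw` would put `x ⊕ y ⊕ v`, another point of the coset, in `N`.
2≤cosetSum : (N : Pred₂ r) → NoClaw N → ∀ {x y v} → Nonadjacent N x y → N ∋ v → 2 ≤ cosetSum x y (ind ∘ N) v
2≤cosetSum N noClaw {x} {y} {v} (x∈N , y∈N , x⊕y∉N) v∈N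
  with N v in eqv | N (v ⊕ x) in eqx | N (v ⊕ y) in eqy | N (v ⊕ x ⊕ y) in eqxy
... | true  | true  | _     | _     = s≤s (s≤s z≤n)
... | true  | false | true  | _     = s≤s (s≤s z≤n)
... | true  | false | false | true  = s≤s (s≤s z≤n)
... | true  | false | false | false = contradiction
  (∋-subst N (solve (v ∷ x ∷ y ∷ []) (Y :⊕ Z :⊕ X) (X :⊕ Y :⊕ Z) refl)
    (noClaw x∈N y∈N eqv x⊕y∉N
      (λ h → Bool.not-¬ eqx (∋-subst N (⊕-comm x v) h))
      (λ h → Bool.not-¬ eqy (∋-subst N (⊕-comm y v) h))))
  (Bool.not-¬ eqxy)

3≤cosetSum : (N : Pred₂ r) → ∀ {x y v} → N ∋ v → N ∋ v ⊕ x → N ∋ v ⊕ y → 3 ≤ cosetSum x y (ind ∘ N) v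
3≤cosetSum N {x} {y} {v} v∈N v⊕x∈N v⊕y∈N with N v | N (v ⊕ x) | N (v ⊕ y)
... | true | true | true = s≤s (s≤s (s≤s z≤n))

cosetSum-positive⁻ : (N : Pred₂ r) (x y t : 𝔽₂^ r) → positive (cosetSum x y (ind ∘ N) t) ≡ true →
  ∃ λ p → InPlane x y p × N ∋ t ⊕ p
cosetSum-positive⁻ N x y t pos
  with N t in eq | N (t ⊕ x) in eqx | N (t ⊕ y) in eqy | N (t ⊕ x ⊕ y) in eqxy
... | true  | _     | _     | _     = 𝟎 , is-𝟎 , ∋-subst N (sym (⊕-identityʳ t)) eq
... | false | true  | _     | _     = x , is-x , eqx
... | false | false | true  | _     = y , is-y , eqy
... | false | false | false | true  = x ⊕ y , is-x⊕y , ∋-subst N (⊕-assoc t x y) eqxy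
cosetSum-positive⁻ N x y t () | false | false | false | false

-- The image of N modulo a nonadjacent pair

module Contraction {r : ℕ} (N : Pred₂ (2 + r)) (0∈N : N ∋ 𝟎) (noClaw : NoClaw N)
                   (x y : 𝔽₂^ (2 + r)) (nonadj : Nonadjacent N x y) where

  open PlaneQuotient
    (planeQuotient x y (nonadjacent⇒x≢𝟎 N nonadj) (nonadjacent⇒y≢𝟎 N nonadj) (nonadjacent⇒x≢y N 0∈N nonadj)) public

  -- The image of `N` under `π`: a point belongs to it when its coset meets `N`. Expressed by the
  -- coset sum, its size can be compared with `∣ N ∣` one coset at a time.
  image : Pred₂ r
  image w = positive (cosetSum x y (ind ∘ N) (σ w))

  image⁺ : ∀ {v} → N ∋ v → image ∋ π v
  image⁺ {v} v∈N = positive⁺ (begin-strict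
    0                                ≤⟨ z≤n ⟩
    1                                <⟨ 2≤cosetSum N noClaw nonadj v∈N ⟩
    cosetSum x y (ind ∘ N) v         ≡⟨ cosetSum-σπ (ind ∘ N) v ⟨
    cosetSum x y (ind ∘ N) (σ (π v)) ∎)
    where open ≤-Reasoning

  π-plane : ∀ {p} → InPlane x y p → π p ≡ 𝟎
  π-plane is-𝟎   = π-𝟎
  π-plane is-x   = π-x
  π-plane is-y   = π-y
  π-plane is-x⊕y = trans (π-⊕ x y) (trans (cong₂ _⊕_ π-x π-y) (⊕-self 𝟎))

  image⁻ : ∀ {w} → image ∋ w → ∃ λ v → N ∋ v × π v ≡ w
  image⁻ {w} w∈image with cosetSum-positive⁻ N x y (σ w) w∈image
  ... | p , inPlane , σw⊕p∈N = σ w ⊕ p , σw⊕p∈N , (begin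
    π (σ w ⊕ p)     ≡⟨ π-⊕ (σ w) p ⟩
    π (σ w) ⊕ π p   ≡⟨ cong₂ _⊕_ (π-σ w) (π-plane inPlane) ⟩
    w ⊕ 𝟎           ≡⟨ ⊕-identityʳ w ⟩
    w               ∎)
    where open ≡-Reasoning

  0∈image : image ∋ 𝟎
  0∈image = ∋-subst image π-𝟎 (image⁺ 0∈N)

  -- Adjacency survives `π`, so any preimages of a pairwise nonadjacent triple are again pairwise
  -- nonadjacent, and `noClaw` applies to them in `N`.
  image-noClaw : NoClaw image
  image-noClaw a∈ b∈ c∈ a⊕b∉ a⊕c∉ b⊕c∉ with image⁻ a∈ | image⁻ b∈ | image⁻ c∈
  ... | a , a∈N , refl | b , b∈N , refl | c , c∈N , refl =
    ∋-subst image (trans (π-⊕ (a ⊕ b) c) (cong (_⊕ π c) (π-⊕ a b)))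
      (image⁺ (noClaw a∈N b∈N c∈N (lift a⊕b∉) (lift a⊕c∉) (lift b⊕c∉)))
    where
    lift : ∀ {u v} → image ∌ π u ⊕ π v → N ∌ u ⊕ v
    lift {u} {v} ∉image u⊕v∈N = ∉image (∋-subst image (π-⊕ u v) (image⁺ u⊕v∈N))

  image-spanning : Spanning N → Spanning image
  image-spanning span P P-⊕ P-image w = subst P (π-σ w)
    (span (P ∘ π) (λ {u} {v} Pu Pv → subst P (sym (π-⊕ u v)) (P-⊕ Pu Pv)) (P-image ∘ image⁺) (σ w))

  2*image≤cosetSum : ∀ w → 2 * ind (image w) ≤ cosetSum x y (ind ∘ N) (σ w)
  2*image≤cosetSum w with image w in eq
  ... | false = z≤n
  ... | true  with image⁻ eq
  ...   | v , v∈N , refl =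
    subst (2 ≤_) (sym (cosetSum-σπ (ind ∘ N) v)) (2≤cosetSum N noClaw nonadj v∈N)

  2*image<cosetSum : ∀ {v} → N ∋ v → N ∋ v ⊕ x → N ∋ v ⊕ y →
    2 * ind (image (π v)) < cosetSum x y (ind ∘ N) (σ (π v))
  2*image<cosetSum {v} v∈N v⊕x∈N v⊕y∈N rewrite image⁺ v∈N =
    subst (3 ≤_) (sym (cosetSum-σπ (ind ∘ N) v)) (3≤cosetSum N v∈N v⊕x∈N v⊕y∈N)

  -- The plane itself contains the three elements `𝟎`, `x` and `y` of `N`.
  2*image<cosetSum-𝟎 : 2 * ind (image (π 𝟎)) < cosetSum x y (ind ∘ N) (σ (π 𝟎))
  2*image<cosetSum-𝟎 = 2*image<cosetSum 0∈N
    (∋-subst N (sym (⊕-identityˡ x)) (proj₁ nonadj)) (∋-subst N (sym (⊕-identityˡ y)) (proj₁ (proj₂ nonadj)))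

  card-image : suc (2 * ∣ image ∣) ≤ ∣ N ∣
  card-image = begin-strict
    2 * ∣ image ∣                             ≡⟨ ∑-*ˡ 2 (ind ∘ image) ⟨
    ∑ (λ w → 2 * ind (image w))               <⟨ ∑-mono-< (π 𝟎) 2*image≤cosetSum 2*image<cosetSum-𝟎 ⟩
    ∑ (λ w → cosetSum x y (ind ∘ N) (σ w))    ≡⟨ ∑-π (ind ∘ N) ⟨
    ∣ N ∣                                     ∎
    where open ≤-Reasoning

  -- The coset of `v` is a second one with a surplus. It differs from the plane: for each nonzero
  -- `v` in the plane, one of the three memberships would say that `x ⊕ y` is in `N`.
  card-image-excess : ∀ {v} → v ≢ 𝟎 → N ∋ v → N ∋ v ⊕ x → N ∋ v ⊕ y → 2 + 2 * ∣ image ∣ ≤ ∣ N ∣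
  card-image-excess {v} v≢𝟎 v∈N v⊕x∈N v⊕y∈N = begin
    2 + 2 * ∣ image ∣                         ≡⟨ cong (2 +_) (∑-*ˡ 2 (ind ∘ image)) ⟨
    2 + ∑ (λ w → 2 * ind (image w))           ≤⟨ ∑-mono-<₂ (π 𝟎) (π v) π𝟎≢πv 2*image≤cosetSum
                                                   2*image<cosetSum-𝟎 (2*image<cosetSum v∈N v⊕x∈N v⊕y∈N) ⟩
    ∑ (λ w → cosetSum x y (ind ∘ N) (σ w))    ≡⟨ ∑-π (ind ∘ N) ⟨
    ∣ N ∣                                     ∎
    where
    open ≤-Reasoning
    x⊕y∉N : N ∌ x ⊕ y
    x⊕y∉N = proj₂ (proj₂ nonadj)
    outside : ∀ {p} → InPlane x y p → p ≢ 𝟎 → N ∋ p → N ∋ p ⊕ x → N ∌ p ⊕ y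
    outside is-𝟎   p≢𝟎 _     _ _     = p≢𝟎 refl
    outside is-x   _   _     _ p⊕y∈N = x⊕y∉N p⊕y∈N
    outside is-y   _   _ p⊕x∈N _     = x⊕y∉N (∋-subst N (⊕-comm y x) p⊕x∈N)
    outside is-x⊕y _   p∈N   _ _     = x⊕y∉N p∈N
    π𝟎≢πv : π 𝟎 ≢ π v
    π𝟎≢πv eq = outside (kernel v (trans (sym eq) π-𝟎)) v≢𝟎 v∈N v⊕x∈N v⊕y∈N

-- The lower bound

halfPowers : ℕ → ℕ
halfPowers r = 2 ^ ⌊ r /2⌋ + 2 ^ ⌈ r /2⌉

halfPowers-2+ : ∀ r → halfPowers (2 + r) ≡ 2 * halfPowers r
halfPowers-2+ r = sym (*-distribˡ-+ 2 (2 ^ ⌊ r /2⌋) _)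

-- A rearrangement of `(m - 1) * (n - 1) ≥ 0`.
m+n≤1+m*n : ∀ {m n} → 0 < m → 0 < n → m + n ≤ suc (m * n)
m+n≤1+m*n {suc m} {suc n} _ _ = begin
  suc m + suc n           ≡⟨ +-comm (suc m) (suc n) ⟩
  suc n + suc m           ≡⟨ +-suc (suc n) m ⟩
  suc (suc n + m)         ≤⟨ s≤s (+-monoʳ-≤ (suc n) (m≤m*n m (suc n))) ⟩
  suc (suc n + m * suc n) ∎
  where open ≤-Reasoning

halfPowers≤1+2^ : ∀ r → halfPowers r ≤ suc (2 ^ r)
halfPowers≤1+2^ r = begin
  halfPowers r                        ≤⟨ m+n≤1+m*n (m^n>0 2 ⌊ r /2⌋) (m^n>0 2 ⌈ r /2⌉) ⟩
  suc (2 ^ ⌊ r /2⌋ * 2 ^ ⌈ r /2⌉)     ≡⟨ cong suc (^-distribˡ-+-* 2 ⌊ r /2⌋ ⌈ r /2⌉) ⟨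
  suc (2 ^ (⌊ r /2⌋ + ⌈ r /2⌉))       ≡⟨ cong (λ m → suc (2 ^ m)) (⌊n/2⌋+⌈n/2⌉≡n r) ⟩
  suc (2 ^ r)                         ∎
  where open ≤-Reasoning

closed-spanning⇒full : (N : Pred₂ r) → Closed N → Spanning N → ∀ v → N ∋ v
closed-spanning⇒full N closed span = span (N ∋_) closed id

-- Since `N` is the ground set with `𝟎` added, `suc ∣ N ∣` is its size plus 2 and the bound avoids
-- truncated subtraction. Each contraction halves `halfPowers` and at least halves `suc ∣ N ∣`.
lowerBound : ∀ r (N : Pred₂ r) → N ∋ 𝟎 → NoClaw N → Spanning N → halfPowers r ≤ suc ∣ N ∣
lowerBound r N 0∈N noClaw span with closed⊎nonadjacent N
... | inj₁ closed = ≤-trans (halfPowers≤1+2^ r) (≤-reflexive (cong suc (sym (trans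
        (∑-cong (λ v → cong ind (closed-spanning⇒full N closed span v))) (∑-1 {r})))))
lowerBound 0 N 0∈N _ _ | inj₂ (_ , _ , nonadj) with nonadjacent-dim N 0∈N nonadj
... | _ , ()
lowerBound 1 N 0∈N _ _ | inj₂ (_ , _ , nonadj) with nonadjacent-dim N 0∈N nonadj
... | _ , ()
lowerBound (suc (suc r)) N 0∈N noClaw span | inj₂ (x , y , nonadj) = begin
  halfPowers (2 + r)        ≡⟨ halfPowers-2+ r ⟩
  2 * halfPowers r          ≤⟨ *-monoʳ-≤ 2 (lowerBound r image 0∈image image-noClaw (image-spanning span)) ⟩
  2 * suc ∣ image ∣         ≡⟨ *-suc 2 ∣ image ∣ ⟩
  suc (suc (2 * ∣ image ∣)) ≤⟨ s≤s card-image ⟩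
  suc ∣ N ∣                 ∎
  where
  open ≤-Reasoning
  open Contraction N 0∈N noClaw x y nonadj

-- The structure of sets attaining the bound

2^-cancel-≤ : ∀ {m n} → 2 ^ m ≤ 2 ^ n → m ≤ n
2^-cancel-≤ 2^m≤2^n = ≮⇒≥ λ n<m → <⇒≱ (^-monoʳ-< 2 ≤-refl n<m) 2^m≤2^n

-- The injection `lincomb b` gives `2 ^ k ≤ 2 ^ r`.
lincomb-dim : (b : Vec (𝔽₂^ r) k) → LinIndep b → k ≤ r
lincomb-dim {r} {k} b indep = 2^-cancel-≤ (begin
  2 ^ k           ≡⟨ ∑-1 {k} ⟨
  ∑ {k} (const 1) ≤⟨ ∑-injection-≤ (lincomb b) (lincomb-injective b indep) (const 1) ⟩
  ∑ {r} (const 1) ≡⟨ ∑-1 {r} ⟩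
  2 ^ r           ∎)
  where open ≤-Reasoning

record PairwiseNonadjacent (N : Pred₂ r) (x y z : 𝔽₂^ r) : Set where
  constructor pairwise
  field
    xy : Nonadjacent N x y
    xz : Nonadjacent N x z
    yz : Nonadjacent N y z

-- The claw for `false` and `C₄` for `true`.
basisOr : Bool → Pred₂ 3
basisOr s (true  ∷ false ∷ false ∷ []) = true
basisOr s (false ∷ true  ∷ false ∷ []) = true
basisOr s (false ∷ false ∷ true  ∷ []) = true
basisOr s (true  ∷ true  ∷ true  ∷ []) = s
basisOr s _                            = false

module _ (N : Pred₂ r) (0∈N : N ∋ 𝟎) {x y z : 𝔽₂^ r} (triple : PairwiseNonadjacent N x y z) where
  open PairwiseNonadjacent triple

  private
    ρ : Vec (𝔽₂^ r) 3
    ρ = x ∷ y ∷ z ∷ []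

    nonzero : ∀ {v} → N ∌ v → v ≢ 𝟎
    nonzero v∉N refl = v∉N 0∈N

  -- The three vectors are nonzero, their pairwise sums lie outside `N` and so differ from `𝟎`, and
  -- if all three summed to `𝟎` then `x ⊕ y` would be `z`, an element of `N`.
  pairwise-independent : LinIndep ρ
  pairwise-independent (false ∷ false ∷ false ∷ []) _  = refl
  pairwise-independent (true  ∷ false ∷ false ∷ []) eq = contradiction
    (trans (sym (lincomb-coefficients ρ X)) eq) (nonadjacent⇒x≢𝟎 N xy)
  pairwise-independent (false ∷ true  ∷ false ∷ []) eq = contradiction
    (trans (sym (lincomb-coefficients ρ Y)) eq) (nonadjacent⇒y≢𝟎 N xy)
  pairwise-independent (false ∷ false ∷ true  ∷ []) eq = contradiction
    (trans (sym (lincomb-coefficients ρ Z)) eq) (nonadjacent⇒y≢𝟎 N xz)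
  pairwise-independent (true  ∷ true  ∷ false ∷ []) eq = contradiction
    (trans (sym (lincomb-coefficients ρ (X :⊕ Y))) eq) (nonzero (proj₂ (proj₂ xy)))
  pairwise-independent (true  ∷ false ∷ true  ∷ []) eq = contradiction
    (trans (sym (lincomb-coefficients ρ (X :⊕ Z))) eq) (nonzero (proj₂ (proj₂ xz)))
  pairwise-independent (false ∷ true  ∷ true  ∷ []) eq = contradiction
    (trans (sym (lincomb-coefficients ρ (Y :⊕ Z))) eq) (nonzero (proj₂ (proj₂ yz)))
  pairwise-independent (true  ∷ true  ∷ true  ∷ []) eq = contradiction
    (∋-subst N (sym (⊕≡𝟎⇒≡ (x ⊕ y) z (trans (sym (lincomb-coefficients ρ (X :⊕ Y :⊕ Z))) eq))) (proj₁ (proj₂ xz)))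
    (proj₂ (proj₂ xy))

  pairwise-restriction : ∀ c → c ≢ 𝟎 → N (lincomb ρ c) ≡ basisOr (N (x ⊕ y ⊕ z)) c
  pairwise-restriction (false ∷ false ∷ false ∷ []) c≢𝟎 = contradiction refl c≢𝟎
  pairwise-restriction (true  ∷ false ∷ false ∷ []) _ =
    trans (cong N (lincomb-coefficients ρ X)) (proj₁ xy)
  pairwise-restriction (false ∷ true  ∷ false ∷ []) _ =
    trans (cong N (lincomb-coefficients ρ Y)) (proj₁ yz)
  pairwise-restriction (false ∷ false ∷ true  ∷ []) _ =
    trans (cong N (lincomb-coefficients ρ Z)) (proj₁ (proj₂ yz))
  pairwise-restriction (true  ∷ true  ∷ false ∷ []) _ =
    trans (cong N (lincomb-coefficients ρ (X :⊕ Y))) (∌⇒false N (proj₂ (proj₂ xy)))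
  pairwise-restriction (true  ∷ false ∷ true  ∷ []) _ =
    trans (cong N (lincomb-coefficients ρ (X :⊕ Z))) (∌⇒false N (proj₂ (proj₂ xz)))
  pairwise-restriction (false ∷ true  ∷ true  ∷ []) _ =
    trans (cong N (lincomb-coefficients ρ (Y :⊕ Z))) (∌⇒false N (proj₂ (proj₂ yz)))
  pairwise-restriction (true  ∷ true  ∷ true  ∷ []) _ =
    cong N (lincomb-coefficients ρ (X :⊕ Y :⊕ Z))

record Extremal (N : Pred₂ r) : Set₁ where
  field
    0∈N      : N ∋ 𝟎
    noClaw   : NoClaw N
    spanning : Spanning N
    tight    : suc ∣ N ∣ ≡ halfPowers r

-- A second coset with three elements makes `∣ N ∣` at least `2 * suc ∣ image ∣`, one more than
-- tightness allows given the lower bound for the image.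
extremal-coset : (N : Pred₂ r) → Extremal N → ∀ {x y} → Nonadjacent N x y →
  ∀ {v} → v ≢ 𝟎 → N ∋ v → N ∋ v ⊕ x → N ∌ v ⊕ y
extremal-coset N ext {x} {y} nonadj {v} v≢𝟎 v∈N v⊕x∈N v⊕y∈N
  with nonadjacent-dim N (Extremal.0∈N ext) nonadj
... | k , refl = <-irrefl refl (begin-strict
  2 * suc ∣ image ∣         ≡⟨ *-suc 2 ∣ image ∣ ⟩
  2 + 2 * ∣ image ∣         ≤⟨ card-image-excess v≢𝟎 v∈N v⊕x∈N v⊕y∈N ⟩
  ∣ N ∣                     <⟨ ≤-refl ⟩
  suc ∣ N ∣                 ≡⟨ tight ⟩
  halfPowers (2 + k)        ≡⟨ halfPowers-2+ k ⟩
  2 * halfPowers k          ≤⟨ *-monoʳ-≤ 2 (lowerBound k image 0∈image image-noClaw (image-spanning spanning)) ⟩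
  2 * suc ∣ image ∣         ∎)
  where
  open ≤-Reasoning
  open Extremal ext
  open Contraction N 0∈N noClaw x y nonadj

-- If `u` and `v` were nonadjacent, then `w`, `w ⊕ u` and `w ⊕ v` would be three elements of `N` in
-- one coset of `⟨u, v⟩`.
adjacent-trans : (N : Pred₂ r) → Extremal N → ∀ {u v w} → w ≢ 𝟎 → N ∋ u → N ∋ v → N ∋ w →
  N ∋ w ⊕ u → N ∋ w ⊕ v → N ∋ u ⊕ v
adjacent-trans N ext w≢𝟎 u∈N v∈N w∈N w⊕u∈N w⊕v∈N = decidable-stable (∋-dec N _) λ u⊕v∉N →
  extremal-coset N ext (u∈N , v∈N , u⊕v∉N) w≢𝟎 w∈N w⊕u∈N w⊕v∈N

pairwise⇒dim≤3 : (N : Pred₂ r) → Extremal N → ∀ {x y z} → PairwiseNonadjacent N x y z → r ≤ 3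
pairwise⇒dim≤3 {0} N ext triple = z≤n
pairwise⇒dim≤3 {1} N ext triple = s≤s z≤n
pairwise⇒dim≤3 {2} N ext triple = s≤s (s≤s z≤n)
pairwise⇒dim≤3 {3} N ext triple = ≤-refl
pairwise⇒dim≤3 {suc (suc (suc (suc s)))} N ext {x} {y} {z} triple =
  contradiction even-odd (even≢odd (halfPowers s) (proj₁ even))
  where
  open Extremal ext
  open PairwiseNonadjacent triple
  open Contraction N 0∈N noClaw x y xy

  x∈N : N ∋ x
  x∈N = proj₁ xy

  y∈N : N ∋ y
  y∈N = proj₁ yz

  z∈N : N ∋ z
  z∈N = proj₁ (proj₂ yz)

  -- `card-image` and the lower bound for the image squeeze `∣ image ∣`. The quotient has dimension
  -- `2 + s`, so its bound is itself a double, which makes `∣ image ∣` odd.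
  image-tight : suc ∣ image ∣ ≡ 2 * halfPowers s
  image-tight = ≤-antisym
    (*-cancelˡ-≤ 2 (begin
      2 * suc ∣ image ∣     ≡⟨ *-suc 2 ∣ image ∣ ⟩
      2 + 2 * ∣ image ∣     ≤⟨ s≤s card-image ⟩
      suc ∣ N ∣             ≡⟨ tight ⟩
      halfPowers (4 + s)    ≡⟨ halfPowers-2+ (2 + s) ⟩
      2 * halfPowers (2 + s) ≡⟨ cong (2 *_) (halfPowers-2+ s) ⟩
      2 * (2 * halfPowers s) ∎))
    (≤-trans (≤-reflexive (sym (halfPowers-2+ s)))
      (lowerBound (2 + s) image 0∈image image-noClaw (image-spanning spanning)))
    where open ≤-Reasoning

  -- A point of the plane lying in `N` is `𝟎`, `x` or `y`, hence adjacent to `x` or to `y`, unlike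
  -- `z`.
  πz≢𝟎 : π z ≢ 𝟎
  πz≢𝟎 πz≡𝟎 = outside (kernel z πz≡𝟎) z∈N (proj₂ (proj₂ xz)) (proj₂ (proj₂ yz))
    where
    outside : ∀ {p} → InPlane x y p → N ∋ p → N ∌ x ⊕ p → ¬ (N ∌ y ⊕ p)
    outside is-𝟎   _ x⊕p∉N _ = x⊕p∉N (∋-subst N (sym (⊕-identityʳ x)) x∈N)
    outside is-x   _ x⊕p∉N _ = x⊕p∉N (∋-subst N (sym (⊕-self x)) 0∈N)
    outside is-y   _ _ y⊕p∉N = y⊕p∉N (∋-subst N (sym (⊕-self y)) 0∈N)
    outside is-x⊕y p∈N _ _   = proj₂ (proj₂ xy) p∈N

  -- Otherwise no point of the coset of `v ⊕ z` is in `N`, so `v` and `z` are nonadjacent. If `v`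
  -- and `x` were nonadjacent too, `noClaw` would put `x ⊕ z ⊕ v` in `N`. So `v` is adjacent to `x`
  -- and likewise to `y`, against `extremal-coset`.
  dominating : ∀ {v} → N ∋ v → image ∋ π v ⊕ π z
  dominating {v} v∈N = decidable-stable (∋-dec image _) λ ∉image →
    let
      ∉N : ∀ {p} → InPlane x y p → N ∌ v ⊕ z ⊕ p
      ∉N {p} inPlane v⊕z⊕p∈N = ∉image (∋-subst image
        (trans (π-⊕ (v ⊕ z) p) (trans (cong₂ _⊕_ (π-⊕ v z) (π-plane inPlane)) (⊕-identityʳ _)))
        (image⁺ v⊕z⊕p∈N))
      v⊕z∉N : N ∌ z ⊕ v
      v⊕z∉N = ∉N is-𝟎 ∘ ∋-subst N (trans (⊕-comm z v) (sym (⊕-identityʳ _)))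
      v⊕x∈N : N ∋ v ⊕ x
      v⊕x∈N = decidable-stable (∋-dec N _) λ v⊕x∉N → ∉N is-x
        (∋-subst N (solve (x ∷ z ∷ v ∷ []) (X :⊕ Y :⊕ Z) (Z :⊕ Y :⊕ X) refl)
          (noClaw x∈N z∈N v∈N (proj₂ (proj₂ xz)) (v⊕x∉N ∘ ∋-subst N (⊕-comm x v)) v⊕z∉N))
      v⊕y∈N : N ∋ v ⊕ y
      v⊕y∈N = decidable-stable (∋-dec N _) λ v⊕y∉N → ∉N is-y
        (∋-subst N (solve (y ∷ z ∷ v ∷ []) (X :⊕ Y :⊕ Z) (Z :⊕ Y :⊕ X) refl)
          (noClaw y∈N z∈N v∈N (proj₂ (proj₂ yz)) (v⊕y∉N ∘ ∋-subst N (⊕-comm y v)) v⊕z∉N))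
      v≢𝟎 : v ≢ 𝟎
      v≢𝟎 v≡𝟎 = v⊕z∉N (∋-subst N (sym (trans (cong (z ⊕_) v≡𝟎) (⊕-identityʳ z))) z∈N)
    in extremal-coset N ext xy v≢𝟎 v∈N v⊕x∈N v⊕y∈N

  translate : ∀ {w} → image ∋ w → image ∋ w ⊕ π z
  translate w∈image with image⁻ w∈image
  ... | v , v∈N , refl = dominating v∈N

  -- By `dominating` the image is invariant under translation by the nonzero vector `π z`.
  even : ∃ λ m → ∣ image ∣ ≡ 2 * m
  even = even-card image (π z) πz≢𝟎 λ w → Bool.⇔→≡ (mk⇔ translate
    (∋-subst image (solve (w ∷ π z ∷ []) (X :⊕ Y :⊕ Y) X refl) ∘ translate))

  even-odd : 2 * halfPowers s ≡ suc (2 * proj₁ even)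
  even-odd = trans (sym image-tight) (cong suc (proj₂ even))

pairwise⇒dim≡3 : (N : Pred₂ r) → Extremal N → ∀ {x y z} → PairwiseNonadjacent N x y z → r ≡ 3
pairwise⇒dim≡3 N ext {x} {y} {z} triple =
  ≤-antisym (pairwise⇒dim≤3 N ext triple) (lincomb-dim (x ∷ y ∷ z ∷ []) (pairwise-independent N (Extremal.0∈N ext) triple))

-- Adjacency classes as subspaces

record Subspace (U : Pred₂ r) : Set where
  field
    contains-𝟎 : U ∋ 𝟎
    closed     : Closed U

TwoSubspaces : Pred₂ r → Set
TwoSubspaces {r} N = Σ (Pred₂ r) λ U₁ → Σ (Pred₂ r) λ U₂ → Subspace U₁ × Subspace U₂ ×
  (∀ {v} → U₁ ∋ v → U₂ ∋ v → v ≡ 𝟎) × (∀ v → N ∋ v ⇔ (U₁ ∋ v ⊎ U₂ ∋ v))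

class : Pred₂ r → 𝔽₂^ r → Pred₂ r
class N x v = does (v ≟ᵛ 𝟎) ∨ (N v ∧ N (v ⊕ x))

-- The vector `𝟎` is adjacent to every element of `N`, and transitivity is available only through
-- nonzero vectors, so the two cases are kept apart.
data InClass (N : Pred₂ r) (x v : 𝔽₂^ r) : Set where
  zero     : v ≡ 𝟎 → InClass N x v
  adjacent : v ≢ 𝟎 → N ∋ v → N ∋ v ⊕ x → InClass N x v

class⁻ : (N : Pred₂ r) (x : 𝔽₂^ r) {v : 𝔽₂^ r} → class N x ∋ v → InClass N x v
class⁻ N x {v} v∈ with v ≟ᵛ 𝟎
... | yes v≡𝟎 = zero v≡𝟎
... | no v≢𝟎  = adjacent v≢𝟎 (Bool.∧-conicalˡ _ _ v∈) (Bool.∧-conicalʳ (N v) _ v∈)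

class⁺ : (N : Pred₂ r) (x : 𝔽₂^ r) {v : 𝔽₂^ r} → InClass N x v → class N x ∋ v
class⁺ N x {v} (zero v≡𝟎) rewrite dec-true (v ≟ᵛ 𝟎) v≡𝟎 = refl
class⁺ N x {v} (adjacent v≢𝟎 v∈N v⊕x∈N)
  rewrite dec-false (v ≟ᵛ 𝟎) v≢𝟎 | v∈N | v⊕x∈N = refl

-- Transitivity is used twice: through `x` it makes `u` and `v` adjacent, so `u ⊕ v` is in `N`;
-- through `u` it makes `u ⊕ v` adjacent to `x`.
class-subspace : (N : Pred₂ r) → Extremal N → ∀ {x} → x ≢ 𝟎 → N ∋ x → Subspace (class N x)
class-subspace N ext {x} x≢𝟎 x∈N = record
  { contains-𝟎 = class⁺ N x {𝟎} (zero refl)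
  ; closed     = λ {u} {v} u∈ v∈ → class⁺ N x {u ⊕ v} (sum (class⁻ N x {u} u∈) (class⁻ N x {v} v∈))
  }
  where
  sum : ∀ {u v} → InClass N x u → InClass N x v → InClass N x (u ⊕ v)
  sum {u} {v} (zero refl) v∈ = subst (InClass N x) (sym (⊕-identityˡ v)) v∈
  sum {u} {v} u∈@(adjacent _ _ _) (zero refl) = subst (InClass N x) (sym (⊕-identityʳ u)) u∈
  sum {u} {v} (adjacent u≢𝟎 u∈N u⊕x∈N) (adjacent v≢𝟎 v∈N v⊕x∈N) with u ⊕ v ≟ᵛ 𝟎
  ... | yes u⊕v≡𝟎 = zero u⊕v≡𝟎
  ... | no  u⊕v≢𝟎 = adjacent u⊕v≢𝟎 u⊕v∈N (adjacent-trans N ext u≢𝟎 u⊕v∈N x∈N u∈N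
      (∋-subst N (solve (u ∷ v ∷ []) Y (X :⊕ (X :⊕ Y)) refl) v∈N) u⊕x∈N)
    where
    u⊕v∈N : N ∋ u ⊕ v
    u⊕v∈N = adjacent-trans N ext x≢𝟎 u∈N v∈N x∈N (∋-subst N (⊕-comm u x) u⊕x∈N) (∋-subst N (⊕-comm v x) v⊕x∈N)

closed⇒twoSubspaces : (N : Pred₂ r) → N ∋ 𝟎 → Closed N → TwoSubspaces N
closed⇒twoSubspaces {r} N 0∈N closed =
  zeroSpace , N , zero-subspace , record { contains-𝟎 = 0∈N ; closed = closed } ,
  (λ v∈ _ → is-zero v∈) ,
  λ v → mk⇔ inj₂ [ (λ v∈ → ∋-subst N (sym (is-zero v∈)) 0∈N) , id ]′
  where
  zeroSpace : Pred₂ r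
  zeroSpace v = does (v ≟ᵛ 𝟎)
  is-zero : ∀ {v} → zeroSpace ∋ v → v ≡ 𝟎
  is-zero {v} v∈ with v ≟ᵛ 𝟎
  ... | yes v≡𝟎 = v≡𝟎
  zero-subspace : Subspace zeroSpace
  zero-subspace = record
    { contains-𝟎 = dec-true (𝟎 {r} ≟ᵛ 𝟎) refl
    ; closed     = λ {u} {v} u∈ v∈ → dec-true (u ⊕ v ≟ᵛ 𝟎) (trans (cong₂ _⊕_ (is-zero {u} u∈) (is-zero {v} v∈)) (⊕-self 𝟎))
    }

-- The classes of `x` and `y` cover `N`, as an element adjacent to neither would complete a triple.
-- They meet only in `𝟎`, as `extremal-coset` forbids a nonzero element adjacent to both.
nonadjacent⇒twoSubspaces : (N : Pred₂ r) → Extremal N → ∀ {x y} → Nonadjacent N x y →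
  (∀ z → ¬ PairwiseNonadjacent N x y z) → TwoSubspaces N
nonadjacent⇒twoSubspaces N ext {x} {y} nonadj@(x∈N , y∈N , x⊕y∉N) ¬triple =
  class N x , class N y ,
  class-subspace N ext (nonadjacent⇒x≢𝟎 N nonadj) x∈N ,
  class-subspace N ext (nonadjacent⇒y≢𝟎 N nonadj) y∈N ,
  (λ v∈₁ v∈₂ → disjoint (class⁻ N x v∈₁) (class⁻ N y v∈₂)) ,
  λ v → mk⇔ (Sum.map (class⁺ N x) (class⁺ N y) ∘ cover) [ member x ∘ class⁻ N x , member y ∘ class⁻ N y ]′
  where
  open Extremal ext
  disjoint : ∀ {v} → InClass N x v → InClass N y v → v ≡ 𝟎
  disjoint (zero v≡𝟎) _ = v≡𝟎
  disjoint (adjacent _ _ _) (zero v≡𝟎) = v≡𝟎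
  disjoint (adjacent v≢𝟎 v∈N v⊕x∈N) (adjacent _ _ v⊕y∈N) =
    contradiction v⊕y∈N (extremal-coset N ext nonadj v≢𝟎 v∈N v⊕x∈N)
  member : ∀ a {v} → InClass N a v → N ∋ v
  member _ (zero refl)        = 0∈N
  member _ (adjacent _ v∈N _) = v∈N
  cover : ∀ {v} → N ∋ v → InClass N x v ⊎ InClass N y v
  cover {v} v∈N with v ≟ᵛ 𝟎 | ∋-dec N (v ⊕ x) | ∋-dec N (v ⊕ y)
  ... | yes v≡𝟎 | _         | _         = inj₁ (zero v≡𝟎)
  ... | no v≢𝟎  | yes v⊕x∈N | _         = inj₁ (adjacent v≢𝟎 v∈N v⊕x∈N)
  ... | no v≢𝟎  | no _      | yes v⊕y∈N = inj₂ (adjacent v≢𝟎 v∈N v⊕y∈N)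
  ... | no _    | no v⊕x∉N  | no v⊕y∉N  = contradiction
    (pairwise nonadj (x∈N , v∈N , v⊕x∉N ∘ ∋-subst N (⊕-comm x v)) (y∈N , v∈N , v⊕y∉N ∘ ∋-subst N (⊕-comm y v)))
    (¬triple v)

extremal-structure : (N : Pred₂ r) → Extremal N →
  (∃ λ x → ∃ λ y → ∃ λ z → PairwiseNonadjacent N x y z) ⊎ TwoSubspaces N
extremal-structure N ext with closed⊎nonadjacent N
... | inj₁ closed = inj₂ (closed⇒twoSubspaces N (Extremal.0∈N ext) closed)
... | inj₂ (x , y , nonadj) with anySubset? (λ z → nonadjacent? N x z ×-dec nonadjacent? N y z)
...   | yes (z , xz , yz) = inj₁ (x , y , z , pairwise nonadj xz yz)
...   | no ¬triple = inj₂ (nonadjacent⇒twoSubspaces N ext nonadj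
        λ z t → ¬triple (z , PairwiseNonadjacent.xz t , PairwiseNonadjacent.yz t))

-- Bases and flats

lincomb-map-∷ : (b : Vec (𝔽₂^ r) k) (c : 𝔽₂^ k) → lincomb (vmap (false ∷_) b) c ≡ false ∷ lincomb b c
lincomb-map-∷ []      []          = refl
lincomb-map-∷ (v ∷ b) (true  ∷ c) = cong ((false ∷ v) ⊕_) (lincomb-map-∷ b c)
lincomb-map-∷ (v ∷ b) (false ∷ c) = cong (𝟎 ⊕_) (lincomb-map-∷ b c)

HasBasis : ℕ → Pred₂ r → Set
HasBasis {r} k U = Σ (Vec (𝔽₂^ r) k) λ b → LinIndep b × ((v : 𝔽₂^ r) → U ∋ v ⇔ ∃ λ c → lincomb b c ≡ v)

-- Induction on the leading coordinate. The members with leading `false` have a basis; if there is a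
-- member `true ∷ u`, adjoining it suffices, since adding it to a member with leading `true` gives
-- one with leading `false`.
subspace-hasBasis : (U : Pred₂ r) → Subspace U → ∃ λ k → HasBasis k U
subspace-hasBasis {zero} U subspace = 0 , [] , (λ { [] _ → refl }) ,
  λ { [] → mk⇔ (const ([] , refl)) (const (Subspace.contains-𝟎 subspace)) }
subspace-hasBasis {suc r} U subspace
  with subspace-hasBasis (λ v → U (false ∷ v))
         (record { contains-𝟎 = Subspace.contains-𝟎 subspace ; closed = Subspace.closed subspace })
     | anySubset? (λ v → ∋-dec U (true ∷ v))
... | k , b , indep , spans | no ¬v = k , vmap (false ∷_) b ,
  (λ c eq → indep c (cong tail (trans (sym (lincomb-map-∷ b c)) eq))) ,
  λ where
    (true  ∷ v) → mk⇔ (λ v∈U → contradiction (v , v∈U) ¬v)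
      λ { (c , eq) → contradiction (trans (sym (lincomb-map-∷ b c)) eq) λ () }
    (false ∷ v) → mk⇔
      (λ v∈U → let (c , eq) = Equivalence.to (spans v) v∈U in c , trans (lincomb-map-∷ b c) (cong (false ∷_) eq))
      λ { (c , eq) → Equivalence.from (spans v) (c , cong tail (trans (sym (lincomb-map-∷ b c)) eq)) }
... | k , b , indep , spans | yes (u , u∈U) = suc k , (true ∷ u) ∷ vmap (false ∷_) b ,
  (λ where
    (true  ∷ c) eq → contradiction (trans (sym (with-u c)) eq) λ ()
    (false ∷ c) eq → cong (false ∷_) (indep c (cong tail (trans (sym (without-u c)) eq)))) ,
  λ where
    (true  ∷ v) → mk⇔
      (λ v∈U → let (c , eq) = Equivalence.to (spans (u ⊕ v)) (Subspace.closed subspace u∈U v∈U) in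
        true ∷ c , trans (with-u c) (cong (true ∷_)
          (trans (cong (u ⊕_) eq) (solve (u ∷ v ∷ []) (X :⊕ (X :⊕ Y)) Y refl))))
      λ where
        (true ∷ c , eq) → ∋-subst U (trans (sym (with-u c)) eq)
          (Subspace.closed subspace u∈U (Equivalence.from (spans _) (c , refl)))
        (false ∷ c , eq) → contradiction (trans (sym (without-u c)) eq) λ ()
    (false ∷ v) → mk⇔
      (λ v∈U → let (c , eq) = Equivalence.to (spans v) v∈U in
        false ∷ c , trans (without-u c) (cong (false ∷_) eq))
      λ where
        (true  ∷ c , eq) → contradiction (trans (sym (with-u c)) eq) λ ()
        (false ∷ c , eq) → Equivalence.from (spans v) (c , cong tail (trans (sym (without-u c)) eq))
  where
  b′ : Vec (𝔽₂^ (suc r)) (suc k)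
  b′ = (true ∷ u) ∷ vmap (false ∷_) b
  with-u : ∀ c → lincomb b′ (true ∷ c) ≡ true ∷ (u ⊕ lincomb b c)
  with-u c = cong ((true ∷ u) ⊕_) (lincomb-map-∷ b c)
  without-u : ∀ c → lincomb b′ (false ∷ c) ≡ false ∷ lincomb b c
  without-u c = trans (⊕-identityˡ _) (lincomb-map-∷ b c)

nonzeroPart : Pred₂ r → Pred₂ r
nonzeroPart U v = U v ∧ not (does (v ≟ᵛ 𝟎))

nonzeroPart⇔ : (U : Pred₂ r) (v : 𝔽₂^ r) → nonzeroPart U ∋ v ⇔ (v ≢ 𝟎 × U ∋ v)
nonzeroPart⇔ U v with v ≟ᵛ 𝟎
... | yes v≡𝟎 = mk⇔ (λ eq → contradiction (trans (sym (Bool.∧-zeroʳ (U v))) eq) λ ()) (λ (v≢𝟎 , _) → contradiction v≡𝟎 v≢𝟎)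
... | no  v≢𝟎 = mk⇔ (λ eq → v≢𝟎 , trans (sym (Bool.∧-identityʳ (U v))) eq) (λ (_ , v∈U) → trans (Bool.∧-identityʳ (U v)) v∈U)

subspace-isFlat : (U : Pred₂ r) → Subspace U → ∃ λ k → IsFlat k (nonzeroPart U)
subspace-isFlat U subspace with subspace-hasBasis U subspace
... | k , b , indep , spans = k , b , indep , λ v → mk⇔
  (λ v∈ → let (v≢𝟎 , v∈U) = Equivalence.to (nonzeroPart⇔ U v) v∈ in v≢𝟎 , Equivalence.to (spans v) v∈U)
  (λ (v≢𝟎 , v∈span) → Equivalence.from (nonzeroPart⇔ U v) (v≢𝟎 , Equivalence.from (spans v) v∈span))

-- Adding `𝟎` turns the indicator of `F` into that of the whole subspace, the image of the injection
-- `lincomb b`.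
flat-card : (F : Pred₂ r) → IsFlat k F → suc ∣ F ∣ ≡ 2 ^ k
flat-card {r} {k} F (b , indep , spans) = begin
  suc ∣ F ∣          ≡⟨ ∑-+δ (ind ∘ F) 𝟎 ⟨
  ∑ f                ≡⟨ ∑-injection-≡ (lincomb b) (lincomb-injective b indep) f outside ⟨
  ∑ (f ∘ lincomb b)  ≡⟨ ∑-cong inside ⟩
  ∑ {k} (const 1)    ≡⟨ ∑-1 {k} ⟩
  2 ^ k              ∎
  where
  open ≡-Reasoning
  f : 𝔽₂^ r → ℕ
  f v = ind (F v) + δ 𝟎 v
  inside : ∀ c → f (lincomb b c) ≡ 1
  inside c with lincomb b c ≟ᵛ 𝟎
  ... | yes eq = cong (λ m → ind m + 1) (∌⇒false F λ v∈F → proj₁ (Equivalence.to (spans _) v∈F) eq)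
  ... | no neq = cong (λ m → ind m + 0) (Equivalence.from (spans _) (neq , c , refl))
  outside : ∀ v → ¬ ∃ (λ c → lincomb b c ≡ v) → f v ≡ 0
  outside v v∉ = cong₂ _+_
    (cong ind (∌⇒false F (v∉ ∘ proj₂ ∘ Equivalence.to (spans v))))
    (δ-≢ {v = v} {𝟎} λ { refl → v∉ (𝟎 , lincomb-𝟎 b) })

DisjointUnion : Pred₂ r → Pred₂ r → Pred₂ r → Set
DisjointUnion {r} E F₁ F₂ =
  ((v : 𝔽₂^ r) → ¬ ((F₁ ∋ v) × (F₂ ∋ v))) × ((v : 𝔽₂^ r) → (E ∋ v) ⇔ ((F₁ ∋ v) ⊎ (F₂ ∋ v)))

disjointUnion-swap : {E F₁ F₂ : Pred₂ r} → DisjointUnion E F₁ F₂ → DisjointUnion E F₂ F₁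
disjointUnion-swap (disjoint , union) = (λ v (v∈₂ , v∈₁) → disjoint v (v∈₁ , v∈₂)) ,
  λ v → mk⇔ (Sum.swap ∘ Equivalence.to (union v)) (Equivalence.from (union v) ∘ Sum.swap)

disjointUnion-card : (E F₁ F₂ : Pred₂ r) → DisjointUnion E F₁ F₂ → ∣ E ∣ ≡ ∣ F₁ ∣ + ∣ F₂ ∣
disjointUnion-card E F₁ F₂ (disjoint , union) = trans (∑-cong pointwise) (∑-+ (ind ∘ F₁) (ind ∘ F₂))
  where
  pointwise : ∀ v → ind (E v) ≡ ind (F₁ v) + ind (F₂ v)
  pointwise v with F₁ v in eq₁ | F₂ v in eq₂
  ... | true  | true  = contradiction (eq₁ , eq₂) (disjoint v)
  ... | true  | false = cong ind (Equivalence.from (union v) (inj₁ eq₁))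
  ... | false | true  = cong ind (Equivalence.from (union v) (inj₂ eq₂))
  ... | false | false = cong ind (∌⇒false E λ v∈E →
    [ Bool.not-¬ eq₁ , Bool.not-¬ eq₂ ]′ (Equivalence.to (union v) v∈E))

flats-card : (E F₁ F₂ : Pred₂ r) {k₁ k₂ : ℕ} → IsFlat k₁ F₁ → IsFlat k₂ F₂ → DisjointUnion E F₁ F₂ →
  2 + ∣ E ∣ ≡ 2 ^ k₁ + 2 ^ k₂
flats-card E F₁ F₂ {k₁} {k₂} flat₁ flat₂ union = begin
  2 + ∣ E ∣               ≡⟨ cong (2 +_) (disjointUnion-card E F₁ F₂ union) ⟩
  2 + (∣ F₁ ∣ + ∣ F₂ ∣)   ≡⟨ cong suc (+-suc ∣ F₁ ∣ ∣ F₂ ∣) ⟨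
  suc ∣ F₁ ∣ + suc ∣ F₂ ∣ ≡⟨ cong₂ _+_ (flat-card F₁ flat₁) (flat-card F₂ flat₂) ⟩
  2 ^ k₁ + 2 ^ k₂         ∎
  where open ≡-Reasoning

-- If `n < b`, then `2 ^ m + 2 ^ n ≤ 2 ^ suc n ≤ 2 ^ b < 2 ^ a + 2 ^ b`. By symmetry the larger
-- exponents agree, and cancelling them leaves the smaller ones.
2^+2^-injective-≤ : ∀ {m n a b} → m ≤ n → a ≤ b → 2 ^ m + 2 ^ n ≡ 2 ^ a + 2 ^ b → m ≡ a × n ≡ b
2^+2^-injective-≤ {m} {n} {a} {b} m≤n a≤b eq = m≡a , n≡b
  where
  larger : ∀ m n a b → m ≤ n → 2 ^ m + 2 ^ n ≡ 2 ^ a + 2 ^ b → b ≤ n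
  larger m n a b m≤n eq = ≮⇒≥ λ n<b → <-irrefl eq (begin-strict
    2 ^ m + 2 ^ n ≤⟨ +-monoˡ-≤ (2 ^ n) (^-monoʳ-≤ 2 m≤n) ⟩
    2 ^ n + 2 ^ n ≡⟨ cong (2 ^ n +_) (+-identityʳ (2 ^ n)) ⟨
    2 ^ suc n     ≤⟨ ^-monoʳ-≤ 2 n<b ⟩
    2 ^ b         <⟨ m<n+m (2 ^ b) (m^n>0 2 a) ⟩
    2 ^ a + 2 ^ b ∎)
    where open ≤-Reasoning
  n≡b : n ≡ b
  n≡b = ≤-antisym (larger a b m n a≤b (sym eq)) (larger m n a b m≤n eq)
  2^m≡2^a : 2 ^ m ≡ 2 ^ a
  2^m≡2^a = +-cancelʳ-≡ (2 ^ b) _ _ (subst (λ p → 2 ^ m + 2 ^ p ≡ 2 ^ a + 2 ^ b) n≡b eq)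
  m≡a : m ≡ a
  m≡a = ≤-antisym (2^-cancel-≤ (≤-reflexive 2^m≡2^a)) (2^-cancel-≤ (≤-reflexive (sym 2^m≡2^a)))

TwoFlats : Pred₂ r → ℕ → ℕ → Set
TwoFlats {r} E a b = Σ (Pred₂ r) λ F₁ → Σ (Pred₂ r) λ F₂ → IsFlat a F₁ × IsFlat b F₂ × DisjointUnion E F₁ F₂

-- The size of the union determines the unordered pair of dimensions; the flats are swapped if the
-- first one is larger.
flats-dims : (E F₁ F₂ : Pred₂ r) {k₁ k₂ a b : ℕ} → IsFlat k₁ F₁ → IsFlat k₂ F₂ → DisjointUnion E F₁ F₂ →
  a ≤ b → 2 + ∣ E ∣ ≡ 2 ^ a + 2 ^ b → TwoFlats E a b
flats-dims E F₁ F₂ {k₁} {k₂} flat₁ flat₂ union a≤b eq with ≤-total k₁ k₂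
... | inj₁ k₁≤k₂ with 2^+2^-injective-≤ k₁≤k₂ a≤b (trans (sym (flats-card E F₁ F₂ flat₁ flat₂ union)) eq)
...   | refl , refl = F₁ , F₂ , flat₁ , flat₂ , union
flats-dims E F₁ F₂ {k₁} {k₂} flat₁ flat₂ union a≤b eq | inj₂ k₂≤k₁
  with 2^+2^-injective-≤ k₂≤k₁ a≤b (trans (sym (flats-card E F₂ F₁ flat₂ flat₁ (disjointUnion-swap union))) eq)
...   | refl , refl = F₂ , F₁ , flat₂ , flat₁ , disjointUnion-swap union

-- Ground sets

withZero : Pred₂ r → Pred₂ r
withZero E v = does (v ≟ᵛ 𝟎) ∨ E v

withZero-≢ : (E : Pred₂ r) {v : 𝔽₂^ r} → v ≢ 𝟎 → withZero E v ≡ E v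
withZero-≢ E {v} v≢𝟎 = cong (_∨ E v) (dec-false (v ≟ᵛ 𝟎) v≢𝟎)

0∈withZero : (E : Pred₂ r) → withZero E ∋ 𝟎
0∈withZero {r} E = cong (_∨ E 𝟎) (dec-true (𝟎 {r} ≟ᵛ 𝟎) refl)

withZero⁺ : (E : Pred₂ r) {v : 𝔽₂^ r} → E ∋ v → withZero E ∋ v
withZero⁺ E {v} v∈E = trans (cong (does (v ≟ᵛ 𝟎) ∨_) v∈E) (Bool.∨-zeroʳ _)

∣withZero∣ : (E : Pred₂ r) → IsGroundSet E → ∣ withZero E ∣ ≡ suc ∣ E ∣
∣withZero∣ E 0∉E = trans (∑-cong pointwise) (∑-+δ (ind ∘ E) 𝟎)
  where
  pointwise : ∀ v → ind (withZero E v) ≡ ind (E v) + δ 𝟎 v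
  pointwise v with v ≟ᵛ 𝟎
  ... | yes refl = cong (λ m → ind m + 1) (sym 0∉E)
  ... | no _     = sym (+-identityʳ (ind (E v)))

fullRank⇒spanning : (E : Pred₂ r) → FullRank E → Spanning (withZero E)
fullRank⇒spanning E fullRank P P-⊕ P-E v with fullRank v
... | xs , xs∈E , refl = go xs xs∈E
  where
  go : ∀ xs → AllIn E xs → P (sumV xs)
  -- The empty sum is `𝟎`, which was added to `E`.
  go []       _            = P-E (0∈withZero E)
  go (x ∷ xs) (x∈E , xs∈E) = P-⊕ (P-E (withZero⁺ E x∈E)) (go xs xs∈E)

-- Applied with `B` the claw when the sum of the triple is missing, and with `C₄` when it is
-- present.
pairwise-inducedIso : (E : Pred₂ r) {x y z : 𝔽₂^ r} → PairwiseNonadjacent (withZero E) x y z →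
  (B : Pred₂ 3) → (∀ c → basisOr (withZero E (x ⊕ y ⊕ z)) c ≡ B c) → InducedIso E B
pairwise-inducedIso E {x} {y} {z} triple B basis≗B = x ∷ y ∷ z ∷ [] , indep , λ c c≢𝟎 →
  trans (sym (withZero-≢ E (c≢𝟎 ∘ indep c)))
    (trans (pairwise-restriction (withZero E) (0∈withZero E) triple c c≢𝟎) (basis≗B c))
  where
  indep : LinIndep (x ∷ y ∷ z ∷ [])
  indep = pairwise-independent (withZero E) (0∈withZero E) triple

basis-isClaw : IsClaw (basisOr false)
basis-isClaw = ⁅ 0F ⁆ ∷ ⁅ 1F ⁆ ∷ ⁅ 2F ⁆ ∷ [] , indep , λ v → mk⇔ (to v) from
  where
  indep : LinIndep (⁅ 0F ⁆ ∷ ⁅ 1F ⁆ ∷ ⁅ 2F ⁆ ∷ [])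
  indep (true  ∷ true  ∷ true  ∷ []) ()
  indep (true  ∷ true  ∷ false ∷ []) ()
  indep (true  ∷ false ∷ true  ∷ []) ()
  indep (true  ∷ false ∷ false ∷ []) ()
  indep (false ∷ true  ∷ true  ∷ []) ()
  indep (false ∷ true  ∷ false ∷ []) ()
  indep (false ∷ false ∷ true  ∷ []) ()
  indep (false ∷ false ∷ false ∷ []) _ = refl
  to : ∀ v → basisOr false ∋ v → v ∈ (⁅ 0F ⁆ ∷ ⁅ 1F ⁆ ∷ ⁅ 2F ⁆ ∷ [])
  to (true  ∷ true  ∷ true  ∷ []) ()
  to (true  ∷ true  ∷ false ∷ []) ()
  to (true  ∷ false ∷ true  ∷ []) ()
  to (false ∷ true  ∷ true  ∷ []) ()
  to (false ∷ false ∷ false ∷ []) ()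
  to (true  ∷ false ∷ false ∷ []) _ = here refl
  to (false ∷ true  ∷ false ∷ []) _ = there (here refl)
  to (false ∷ false ∷ true  ∷ []) _ = there (there (here refl))
  from : ∀ {v} → v ∈ (⁅ 0F ⁆ ∷ ⁅ 1F ⁆ ∷ ⁅ 2F ⁆ ∷ []) → basisOr false ∋ v
  from (here refl)                 = refl
  from (there (here refl))         = refl
  from (there (there (here refl))) = refl

clawFree⇒noClaw : (E : Pred₂ r) → ClawFree E → NoClaw (withZero E)
clawFree⇒noClaw E clawFree x∈ y∈ z∈ x⊕y∉ x⊕z∉ y⊕z∉ = decidable-stable (∋-dec (withZero E) _) λ x⊕y⊕z∉ →
  clawFree (basisOr false) basis-isClaw
    (pairwise-inducedIso E (pairwise (x∈ , y∈ , x⊕y∉) (x∈ , z∈ , x⊕z∉) (y∈ , z∈ , y⊕z∉)) (basisOr false)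
      λ c → cong (λ s → basisOr s c) (∌⇒false (withZero E) x⊕y⊕z∉))

basisOr-true≗C₄ : ∀ c → basisOr true c ≡ C₄ c
basisOr-true≗C₄ (true  ∷ true  ∷ true  ∷ []) = refl
basisOr-true≗C₄ (true  ∷ true  ∷ false ∷ []) = refl
basisOr-true≗C₄ (true  ∷ false ∷ true  ∷ []) = refl
basisOr-true≗C₄ (true  ∷ false ∷ false ∷ []) = refl
basisOr-true≗C₄ (false ∷ true  ∷ true  ∷ []) = refl
basisOr-true≗C₄ (false ∷ true  ∷ false ∷ []) = refl
basisOr-true≗C₄ (false ∷ false ∷ true  ∷ []) = refl
basisOr-true≗C₄ (false ∷ false ∷ false ∷ []) = refl

-- The embedding bounds E′ by E and the complement of E′ by that of E, and the totals agree,
-- so surjectivity of the isomorphism is not needed.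
isomorphic⇒∣∣≡ : (E : Pred₂ r) (E′ : Pred₂ k) → IsGroundSet E → IsGroundSet E′ → Isomorphic E E′ → ∣ E ∣ ≡ ∣ E′ ∣
isomorphic⇒∣∣≡ {r} E E′ 0∉E 0∉E′ (refl , b , indep , restriction) = ≤-antisym
  (+-cancelʳ-≤ ∣ not ∘ E′ ∣ _ _ (begin
    ∣ E ∣ + ∣ not ∘ E′ ∣  ≤⟨ +-monoʳ-≤ ∣ E ∣ (embed not) ⟩
    ∣ E ∣ + ∣ not ∘ E ∣   ≡⟨ complement E ⟩
    2 ^ r                 ≡⟨ complement E′ ⟨
    ∣ E′ ∣ + ∣ not ∘ E′ ∣ ∎))
  (embed id)
  where
  open ≤-Reasoning
  pullback : ∀ c → E (lincomb b c) ≡ E′ c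
  pullback c with c ≟ᵛ 𝟎
  ... | yes refl = trans (cong E (lincomb-𝟎 b)) (trans 0∉E (sym 0∉E′))
  ... | no c≢𝟎   = restriction c c≢𝟎
  embed : (g : Bool → Bool) → ∣ g ∘ E′ ∣ ≤ ∣ g ∘ E ∣
  embed g = ≤-trans (≤-reflexive (∑-cong (λ c → cong (ind ∘ g) (sym (pullback c)))))
    (∑-injection-≤ (lincomb b) (lincomb-injective b indep) (ind ∘ g ∘ E))
  complement : (F : Pred₂ r) → ∣ F ∣ + ∣ not ∘ F ∣ ≡ 2 ^ r
  complement F = trans (sym (∑-+ (ind ∘ F) (ind ∘ not ∘ F))) (trans (∑-cong pointwise) (∑-1 {r}))
    where
    pointwise : ∀ v → ind (F v) + ind (not (F v)) ≡ 1
    pointwise v with F v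
    ... | true  = refl
    ... | false = refl

twoSubspaces⇒disjointUnion : (E : Pred₂ r) → IsGroundSet E → (twoSubspaces : TwoSubspaces (withZero E)) →
  DisjointUnion E (nonzeroPart (proj₁ twoSubspaces)) (nonzeroPart (proj₁ (proj₂ twoSubspaces)))
twoSubspaces⇒disjointUnion E 0∉E (U₁ , U₂ , _ , _ , meet , union) =
  (λ v (v∈₁ , v∈₂) →
    let (v≢𝟎 , v∈U₁) = Equivalence.to (nonzeroPart⇔ U₁ v) v∈₁
        (_   , v∈U₂) = Equivalence.to (nonzeroPart⇔ U₂ v) v∈₂
    in v≢𝟎 (meet v∈U₁ v∈U₂)) ,
  λ v → mk⇔
    (λ v∈E →
      let v≢𝟎 = λ v≡𝟎 → Bool.not-¬ 0∉E (∋-subst E v≡𝟎 v∈E)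
      in Sum.map (λ v∈ → Equivalence.from (nonzeroPart⇔ U₁ v) (v≢𝟎 , v∈))
                 (λ v∈ → Equivalence.from (nonzeroPart⇔ U₂ v) (v≢𝟎 , v∈))
                 (Equivalence.to (union v) (withZero⁺ E v∈E)))
    [ (λ v∈ → let (v≢𝟎 , v∈U₁) = Equivalence.to (nonzeroPart⇔ U₁ v) v∈ in
        trans (sym (withZero-≢ E v≢𝟎)) (Equivalence.from (union v) (inj₁ v∈U₁)))
    , (λ v∈ → let (v≢𝟎 , v∈U₂) = Equivalence.to (nonzeroPart⇔ U₂ v) v∈ in
        trans (sym (withZero-≢ E v≢𝟎)) (Equivalence.from (union v) (inj₂ v∈U₂))) ]′

-- The bound and the equality cases for the ground set

module _ (r : ℕ) (E : Pred₂ r) (0∉E : IsGroundSet E) (fullRank : FullRank E) (clawFree : ClawFree E) where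

  2+card≡1+∣withZero∣ : 2 + card E ≡ suc ∣ withZero E ∣
  2+card≡1+∣withZero∣ = cong suc (trans (cong suc (card≡∣∣ E)) (sym (∣withZero∣ E 0∉E)))

  halfPowers≤2+card : halfPowers r ≤ 2 + card E
  halfPowers≤2+card = ≤-trans
    (lowerBound r (withZero E) (0∈withZero E) (clawFree⇒noClaw E clawFree) (fullRank⇒spanning E fullRank))
    (≤-reflexive (sym 2+card≡1+∣withZero∣))

  equality⇒structure : 2 + card E ≡ halfPowers r → Isomorphic E C₄ ⊎ TwoFlats E ⌊ r /2⌋ ⌈ r /2⌉
  equality⇒structure tight = Sum.map isomorphic flats (extremal-structure (withZero E) extremal)
    where
    extremal : Extremal (withZero E)
    extremal = record
      { 0∈N      = 0∈withZero E
      ; noClaw   = clawFree⇒noClaw E clawFree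
      ; spanning = fullRank⇒spanning E fullRank
      ; tight    = trans (sym 2+card≡1+∣withZero∣) tight
      }
    isomorphic : (∃ λ x → ∃ λ y → ∃ λ z → PairwiseNonadjacent (withZero E) x y z) → Isomorphic E C₄
    isomorphic (x , y , z , triple@(pairwise (x∈ , y∈ , x⊕y∉) (_ , z∈ , x⊕z∉) (_ , _ , y⊕z∉))) =
      pairwise⇒dim≡3 (withZero E) extremal triple ,
      pairwise-inducedIso E triple C₄ λ c → trans
        -- Claw-freeness puts the sum of the triple in the set, which selects `basisOr true`.
        (cong (λ s → basisOr s c) (Extremal.noClaw extremal x∈ y∈ z∈ x⊕y∉ x⊕z∉ y⊕z∉))
        (basisOr-true≗C₄ c)
    flats : TwoSubspaces (withZero E) → TwoFlats E ⌊ r /2⌋ ⌈ r /2⌉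
    flats twoSubspaces@(U₁ , U₂ , subspace₁ , subspace₂ , _) =
      flats-dims E (nonzeroPart U₁) (nonzeroPart U₂)
        (proj₂ (subspace-isFlat U₁ subspace₁)) (proj₂ (subspace-isFlat U₂ subspace₂))
        (twoSubspaces⇒disjointUnion E 0∉E twoSubspaces)
        (⌊n/2⌋≤⌈n/2⌉ r) (trans (cong (2 +_) (sym (card≡∣∣ E))) tight)

  structure⇒equality : Isomorphic E C₄ ⊎ TwoFlats E ⌊ r /2⌋ ⌈ r /2⌉ → 2 + card E ≡ halfPowers r
  -- With `r` equal to 3, `2 + ∣ C₄ ∣` and `halfPowers r` both compute to 6.
  structure⇒equality (inj₁ iso@(refl , _)) = cong (2 +_) (trans (card≡∣∣ E) (isomorphic⇒∣∣≡ E C₄ 0∉E refl iso))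
  structure⇒equality (inj₂ (F₁ , F₂ , flat₁ , flat₂ , union)) =
    trans (cong (2 +_) (card≡∣∣ E)) (flats-card E F₁ F₂ flat₁ flat₂ union)

theorem1p8 : (r : ℕ) (E : Pred₂ r) → IsGroundSet E → FullRank E → ClawFree E →
    (2 ^ ⌊ r /2⌋ + 2 ^ ⌈ r /2⌉ ∸ 2 ≤ card E) ×
    ((card E ≡ 2 ^ ⌊ r /2⌋ + 2 ^ ⌈ r /2⌉ ∸ 2) ⇔
    (Isomorphic E C₄ ⊎
    Σ (Pred₂ r) λ F₁ → Σ (Pred₂ r) λ F₂ →
    IsFlat ⌊ r /2⌋ F₁ × IsFlat ⌈ r /2⌉ F₂ ×
    ((v : 𝔽₂^ r) → ¬ ((F₁ v ≡ true) × (F₂ v ≡ true))) ×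
    ((v : 𝔽₂^ r) → (E v ≡ true) ⇔ ((F₁ v ≡ true) ⊎ (F₂ v ≡ true)))))
theorem1p8 r E 0∉E fullRank clawFree =
  m≤n+o⇒m∸n≤o (halfPowers r) 2 (halfPowers≤2+card r E 0∉E fullRank clawFree) ,
  mk⇔
    (λ eq → equality⇒structure r E 0∉E fullRank clawFree (trans (cong (2 +_) eq) (m+[n∸m]≡n 2≤)))
    (λ structure → cong (_∸ 2) (structure⇒equality r E 0∉E fullRank clawFree structure))
  where
  -- Ensures that the truncated subtraction of 2 in the bound can be undone.
  2≤ : 2 ≤ halfPowers r
  2≤ = +-mono-≤ (m^n>0 2 ⌊ r /2⌋) (m^n>0 2 ⌈ r /2⌉)
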